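{- Let $n\ge1$ be an integer and $K_n$ the complete graph on $n$ vertices. (a) $K_n$ is $\{ -1,0,1\}$-diagonalizable, with $\{ -1,0,1\}$-bandwidth at most $2$. (b) $K_n$ is $\{ -1,1\}$-diagonalizable if and only if $n=1$ or $n$ is even. Furthermore: (i) if $n\equiv 2\pmod 4$ then $K_n$ has $\{ -1,1\}$-bandwidth $n-1$; and (ii) if there exists a Hadamard matrix of order $n$, then $K_n$ has $\{ -1,1\}$-bandwidth $1$.
   Context: For a simple graph with adjacency matrix $A$ and degree matrix $D$, the Laplacian is $L=D-A$. For a set $S$, a graph is $S$-diagonalizable if there is an invertible matrix $P$ with all entries in $S$ such that $P^{ -1}LP$ is diagonal. The bandwidth of a square matrix $M$ is the smallest positive integer $k$ with $m_{i,j}=0$ whenever $|i-j|\ge k$. The $S$-bandwidth of an $S$-diagonalizable graph is the smallest positive integer $k$ for which there is a matrix $P$ with entries in $S$, $P^{ -1}LP$ diagonal and $P^TP$ of bandwidth $k$ (and $\infty$ if the graph is not $S$-diagonalizable). A Hadamard matrix of order $n$ is an $n\times n$ matrix with entries in $\{ -1,1\}$ whose columns are mutually orthogonal. -}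

module Defs where

open import Data.Nat as ℕ using (ℕ; zero; suc; _∸_)
open import Data.Bool using (Bool; true; false; if_then_else_; not)
open import Data.Fin using (Fin; toℕ)
open import Data.Fin.Properties using (_≟_)
open import Data.Integer as ℤ using (ℤ)
open import Data.Rational as ℚ using (ℚ; 0ℚ; 1ℚ; -_; _+_; _*_; _-_)
open import Data.Product using (Σ; ∃; _×_; _,_)
open import Data.Sum using (_⊎_)
open import Relation.Binary.PropositionalEquality using (_≡_; _≢_)
open import Relation.Nullary.Decidable using (⌊_⌋)

Matrix : ℕ → Set
Matrix n = Fin n → Fin n → ℚ

∑ : ∀ {n} → (Fin n → ℚ) → ℚ
∑ {zero}  f = 0ℚ
∑ {suc n} f = f Fin.zero + ∑ (λ i → f (Fin.suc i))

_⊗_ : ∀ {n} → Matrix n → Matrix n → Matrix n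
(M ⊗ N) i j = ∑ (λ k → M i k * N k j)

infixl 7 _⊗_

transpose : ∀ {n} → Matrix n → Matrix n
transpose M i j = M j i

identity : ∀ {n} → Matrix n
identity i j = if ⌊ i ≟ j ⌋ then 1ℚ else 0ℚ

IsDiagonal : ∀ {n} → Matrix n → Set
IsDiagonal M = ∀ i j → i ≢ j → M i j ≡ 0ℚ

record Graph (n : ℕ) : Set where
  field
    adj       : Fin n → Fin n → Bool
    adj-sym   : ∀ i j → adj i j ≡ adj j i
    adj-irrefl : ∀ i → adj i i ≡ false
open Graph public

b2ℚ : Bool → ℚ
b2ℚ true  = 1ℚ
b2ℚ false = 0ℚ

adjacencyMatrix : ∀ {n} → Graph n → Matrix n
adjacencyMatrix G i j = b2ℚ (adj G i j)

degreeMatrix : ∀ {n} → Graph n → Matrix n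
degreeMatrix G i j =
  if ⌊ i ≟ j ⌋ then ∑ (λ k → adjacencyMatrix G i k) else 0ℚ

laplacian : ∀ {n} → Graph n → Matrix n
laplacian G i j = degreeMatrix G i j - adjacencyMatrix G i j

completeGraph : (n : ℕ) → Graph n
completeGraph n = record
  { adj = λ i j → not ⌊ i ≟ j ⌋
  ; adj-sym = sym-lemma
  ; adj-irrefl = irr
  }
  where
  open import Relation.Binary.PropositionalEquality using (refl; sym)
  open import Relation.Nullary using (yes; no)
  sym-lemma : ∀ i j → not ⌊ i ≟ j ⌋ ≡ not ⌊ j ≟ i ⌋
  sym-lemma i j with i ≟ j | j ≟ i
  ... | yes _ | yes _ = refl
  ... | no _  | no _  = refl
  ... | yes p | no q  with q (sym p)
  ... | ()
  sym-lemma i j | no p | yes q with p (sym q)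
  ... | ()
  irr : ∀ i → not ⌊ i ≟ i ⌋ ≡ false
  irr i with i ≟ i
  ... | yes _ = refl
  ... | no p with p refl
  ... | ()

Subset : Set₁
Subset = ℚ → Set

S₋₁₀₁ : Subset
S₋₁₀₁ x = (x ≡ - 1ℚ) ⊎ (x ≡ 0ℚ) ⊎ (x ≡ 1ℚ)

S₋₁₁ : Subset
S₋₁₁ x = (x ≡ - 1ℚ) ⊎ (x ≡ 1ℚ)

EntriesIn : ∀ {n} → Subset → Matrix n → Set
EntriesIn S P = ∀ i j → S (P i j)

-- P (entries in S) is invertible and P⁻¹ L P is diagonal.
-- The inverse is taken over ℚ (the inverse of a rational matrix invertible
-- over ℝ is rational, so this agrees with the real reading).
Diagonalizes : ∀ {n} → Subset → Graph n → Matrix n → Set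
Diagonalizes {n} S G P =
  EntriesIn S P ×
  Σ (Matrix n) λ Q →
    (∀ i j → (Q ⊗ P) i j ≡ identity i j) ×
    (∀ i j → (P ⊗ Q) i j ≡ identity i j) ×
    IsDiagonal (Q ⊗ laplacian G ⊗ P)

SDiagonalizable : ∀ {n} → Subset → Graph n → Set
SDiagonalizable {n} S G = Σ (Matrix n) λ P → Diagonalizes S G P

dist : ∀ {n} → Fin n → Fin n → ℕ
dist i j = (toℕ i ∸ toℕ j) ℕ.+ (toℕ j ∸ toℕ i)

ZeroOutsideBand : ∀ {n} → Matrix n → ℕ → Set
ZeroOutsideBand M k = ∀ i j → k ℕ.≤ dist i j → M i j ≡ 0ℚ

IsBandwidth : ∀ {n} → Matrix n → ℕ → Set
IsBandwidth M k =
  1 ℕ.≤ k × ZeroOutsideBand M k ×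
  (∀ k′ → 1 ℕ.≤ k′ → ZeroOutsideBand M k′ → k ℕ.≤ k′)

IsSBandwidth : ∀ {n} → Subset → Graph n → ℕ → Set
IsSBandwidth {n} S G k =
  (Σ (Matrix n) λ P → Diagonalizes S G P × IsBandwidth (transpose P ⊗ P) k) ×
  (∀ (P : Matrix n) k′ → Diagonalizes S G P → IsBandwidth (transpose P ⊗ P) k′ → k ℕ.≤ k′)

IsHadamard : ∀ {n} → Matrix n → Set
IsHadamard H =
  EntriesIn S₋₁₁ H ×
  (∀ i j → i ≢ j → ∑ (λ k → H k i * H k j) ≡ 0ℚ)

HadamardExists : ℕ → Set
HadamardExists n = Σ (Matrix n) IsHadamard

{-# OPTIONS --safe #-}
module Submission where

-- The Laplacian of Kₙ is n I − J, so an invertible P diagonalizes it exactly when every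
-- column of P is constant or balanced (has zero sum). Over ±1 at most one column can be
-- constant, and a balanced ±1 column u gives n = Σ (1 + uᵢ) ∈ 2ℤ. For two balanced ±1
-- columns, Σ (1 + uᵢ)(1 + vᵢ) = n + u·v is a multiple of 4; so if n ≡ 2 (mod 4) the only
-- zeros of PᵀP off the diagonal lie in the row and column of the constant vector, and the
-- bandwidth is at least n − 1, with equality when that vector comes first.
--
-- For {-1,0,1} the columns 1, e₁ − e₂, e₂ − e₃, … have bandwidth 2. Whether the minimum is
-- 1 or 2 depends on n and is decided by searching the finitely many {-1,0,1}-matrices for
-- an orthogonal eigenbasis.

open import Defs
open import Data.Nat using (ℕ; _≤_; _∸_; _%_)
open import Data.Nat.Divisibility using (_∣_)
open import Data.Product using (Σ; _×_)
open import Data.Sum using (_⊎_)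
open import Function.Bundles using (_⇔_)
open import Relation.Binary.PropositionalEquality using (_≡_)
open import Algebra.Bundles using (CommutativeRing)
open import Data.Bool using (true; false; if_then_else_; not)
open import Data.Fin using (Fin; zero; suc; punchIn; punchOut; inject₁; toℕ; fromℕ; finToFun; funToFin)
import Data.Fin as Fin
open import Data.Fin.Properties
  using (_≟_; all?; any?; ¬∀⟶∃¬; <⇒≢; suc-injective; inject₁-injective; toℕ<n; toℕ-inject₁;
         toℕ-fromℕ; punchIn-punchOut; finToFun-funToFin)
open import Data.Nat as ℕ using (zero; suc; z≤n; s≤s)
open import Data.Nat.DivMod using (m≡m%n+[m/n]*n)
open import Data.Nat.Divisibility using (divides; n∣m⇒m%n≡0)
import Data.Nat.Properties as ℕ
open import Data.Product using (∃; _,_; proj₁; proj₂)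
open import Data.Rational using (ℚ; 0ℚ; 1ℚ; -_; _+_; _*_; _-_; 1/_; ≢-nonZero; NonNegative)
open import Data.Rational.Properties
  using (+-*-commutativeRing; +-0-group; +-identityˡ; +-identityʳ; +-inverseʳ; *-assoc; *-comm;
         *-identityˡ; *-identityʳ; *-inverseˡ; *-zeroˡ; *-zeroʳ; <-irrefl; positive⁻¹;
         nonNeg+nonNeg⇒nonNeg; pos+nonNeg⇒pos)
  renaming (_≟_ to _≟ℚ_)
open import Data.Rational.Solver using (module +-*-Solver)
open import Data.Sum using (inj₁; inj₂)
open import Function using (_∘_; mk⇔)
open import Relation.Binary.PropositionalEquality
  using (_≢_; _≗_; refl; sym; trans; cong; cong₂; subst; module ≡-Reasoning)
open import Relation.Nullary using (Dec; yes; no; ¬_; contradiction)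
open import Relation.Nullary.Decidable using (⌊_⌋; map′; ¬?; _→-dec_; _×-dec_; _⊎-dec_)

import Algebra.Properties.Semiring.Mult (CommutativeRing.semiring +-*-commutativeRing) as Mult
import Algebra.Properties.Semiring.Sum (CommutativeRing.semiring +-*-commutativeRing) as Sum
open import Algebra.Properties.Group +-0-group using (x∙y⁻¹≈ε⇒x≈y)
open +-*-Solver using (solve; _:=_; _:+_; _:*_; :-_; _:-_; con)
open ≡-Reasoning

-- Finite sums of rationals and the identity matrix

infixr 8 _·_
-- Repeated addition. `n · 1ℚ` serves as the image of n in ℚ, since it unfolds by successors in step
-- with `∑`.
_·_ : ℕ → ℚ → ℚ
_·_ = Mult._×_

x*y≡0⇒y≡0 : ∀ {x y} → x ≢ 0ℚ → x * y ≡ 0ℚ → y ≡ 0ℚ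
x*y≡0⇒y≡0 {x} {y} x≢0 xy≡0 = begin
  y              ≡⟨ *-identityˡ y ⟨
  1ℚ * y         ≡⟨ cong (_* y) (*-inverseˡ x) ⟨
  1/ x * x * y   ≡⟨ *-assoc (1/ x) x y ⟩
  1/ x * (x * y) ≡⟨ cong (1/ x *_) xy≡0 ⟩
  1/ x * 0ℚ      ≡⟨ *-zeroʳ (1/ x) ⟩
  0ℚ             ∎
  where instance _ = ≢-nonZero x≢0

∑≡sum : ∀ {n} (f : Fin n → ℚ) → ∑ f ≡ Sum.sum f
∑≡sum {zero}  f = refl
∑≡sum {suc n} f = cong (f zero +_) (∑≡sum (f ∘ suc))

∑-cong : ∀ {n} {f g : Fin n → ℚ} → f ≗ g → ∑ f ≡ ∑ g
∑-cong {f = f} {g} f≗g = begin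
  ∑ f       ≡⟨ ∑≡sum f ⟩
  Sum.sum f ≡⟨ Sum.sum-cong-≗ f≗g ⟩
  Sum.sum g ≡⟨ ∑≡sum g ⟨
  ∑ g       ∎

∑-const : ∀ n x → ∑ {n} (λ _ → x) ≡ n · x
∑-const n x = trans (∑≡sum {n} (λ _ → x)) (Sum.sum-replicate n)

∑-0 : ∀ {n} {f : Fin n → ℚ} → (∀ i → f i ≡ 0ℚ) → ∑ f ≡ 0ℚ
∑-0 {n} f≡0 = trans (∑-cong f≡0) (trans (∑≡sum {n} (λ _ → 0ℚ)) (Sum.sum-replicate-zero n))

∑-+ : ∀ {n} (f g : Fin n → ℚ) → ∑ (λ i → f i + g i) ≡ ∑ f + ∑ g
∑-+ f g = begin
  ∑ (λ i → f i + g i)       ≡⟨ ∑≡sum (λ i → f i + g i) ⟩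
  Sum.sum (λ i → f i + g i) ≡⟨ Sum.∑-distrib-+ f g ⟩
  Sum.sum f + Sum.sum g     ≡⟨ cong₂ _+_ (∑≡sum f) (∑≡sum g) ⟨
  ∑ f + ∑ g                 ∎

∑-*ˡ : ∀ {n} c (f : Fin n → ℚ) → ∑ (λ i → c * f i) ≡ c * ∑ f
∑-*ˡ c f = begin
  ∑ (λ i → c * f i)       ≡⟨ ∑≡sum (λ i → c * f i) ⟩
  Sum.sum (λ i → c * f i) ≡⟨ Sum.*-distribˡ-sum c f ⟨
  c * Sum.sum f           ≡⟨ cong (c *_) (∑≡sum f) ⟨
  c * ∑ f                 ∎

∑-*ʳ : ∀ {n} c (f : Fin n → ℚ) → ∑ (λ i → f i * c) ≡ ∑ f * c
∑-*ʳ c f = begin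
  ∑ (λ i → f i * c) ≡⟨ ∑-cong (λ i → *-comm (f i) c) ⟩
  ∑ (λ i → c * f i) ≡⟨ ∑-*ˡ c f ⟩
  c * ∑ f           ≡⟨ *-comm c (∑ f) ⟩
  ∑ f * c           ∎

∑-neg : ∀ {n} (f : Fin n → ℚ) → ∑ (λ i → - f i) ≡ - ∑ f
∑-neg f = begin
  ∑ (λ i → - f i)      ≡⟨ ∑-cong (λ i → solve 1 (λ x → :- x := con (- 1ℚ) :* x) refl (f i)) ⟩
  ∑ (λ i → - 1ℚ * f i) ≡⟨ ∑-*ˡ (- 1ℚ) f ⟩
  - 1ℚ * ∑ f           ≡⟨ solve 1 (λ x → con (- 1ℚ) :* x := :- x) refl (∑ f) ⟩
  - ∑ f                ∎

∑-sub : ∀ {n} (f g : Fin n → ℚ) → ∑ (λ i → f i - g i) ≡ ∑ f - ∑ g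
∑-sub f g = trans (∑-+ f (-_ ∘ g)) (cong (∑ f +_) (∑-neg g))

∑-swap : ∀ {m n} (f : Fin m → Fin n → ℚ) →
         ∑ (λ i → ∑ (λ j → f i j)) ≡ ∑ (λ j → ∑ (λ i → f i j))
∑-swap f = begin
  ∑ (λ i → ∑ (f i))                         ≡⟨ ∑-cong (λ i → ∑≡sum (f i)) ⟩
  ∑ (λ i → Sum.sum (f i))                   ≡⟨ ∑≡sum (λ i → Sum.sum (f i)) ⟩
  Sum.sum (λ i → Sum.sum (f i))             ≡⟨ Sum.∑-comm f ⟩
  Sum.sum (λ j → Sum.sum (λ i → f i j))     ≡⟨ ∑≡sum (λ j → Sum.sum (λ i → f i j)) ⟨
  ∑ (λ j → Sum.sum (λ i → f i j))           ≡⟨ ∑-cong (λ j → ∑≡sum (λ i → f i j)) ⟨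
  ∑ (λ j → ∑ (λ i → f i j))                 ∎

∑-single : ∀ {n} {f : Fin n → ℚ} j → (∀ i → i ≢ j → f i ≡ 0ℚ) → ∑ f ≡ f j
∑-single {suc n} {f} zero f≡0 =
  trans (cong (f zero +_) (∑-0 (λ i → f≡0 (suc i) (λ ())))) (+-identityʳ (f zero))
∑-single {suc n} {f} (suc j) f≡0 = begin
  f zero + ∑ (f ∘ suc) ≡⟨ cong₂ _+_ (f≡0 zero (λ ())) (∑-single j λ i i≢j → f≡0 (suc i) λ { refl → i≢j refl }) ⟩
  0ℚ + f (suc j)       ≡⟨ +-identityˡ (f (suc j)) ⟩
  f (suc j)            ∎

identity-diag : ∀ {n} (i : Fin n) → identity i i ≡ 1ℚ
identity-diag i with i ≟ i
... | yes _  = refl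
... | no i≢i = contradiction refl i≢i

identity-off : ∀ {n} {i j : Fin n} → i ≢ j → identity i j ≡ 0ℚ
identity-off {i = i} {j} i≢j with i ≟ j
... | yes i≡j = contradiction i≡j i≢j
... | no _    = refl

identity-sym : ∀ {n} (i j : Fin n) → identity i j ≡ identity j i
identity-sym i j with i ≟ j
... | yes refl = sym (identity-diag i)
... | no i≢j   = sym (identity-off (i≢j ∘ sym))

∑-*-identity : ∀ {n} (f : Fin n → ℚ) j → ∑ (λ i → f i * identity i j) ≡ f j
∑-*-identity f j = begin
  ∑ (λ i → f i * identity i j) ≡⟨ ∑-single j (λ i i≢j → trans (cong (f i *_) (identity-off i≢j)) (*-zeroʳ (f i))) ⟩
  f j * identity j j           ≡⟨ cong (f j *_) (identity-diag j) ⟩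
  f j * 1ℚ                     ≡⟨ *-identityʳ (f j) ⟩
  f j                          ∎

∑-identity-* : ∀ {n} (f : Fin n → ℚ) i → ∑ (λ j → identity i j * f j) ≡ f i
∑-identity-* f i = trans
  (∑-cong (λ j → trans (*-comm (identity i j) (f j)) (cong (f j *_) (identity-sym i j))))
  (∑-*-identity f i)

∑-identity : ∀ {n} (j : Fin n) → ∑ (λ i → identity i j) ≡ 1ℚ
∑-identity j = trans (∑-cong (λ i → sym (*-identityˡ (identity i j)))) (∑-*-identity (λ _ → 1ℚ) j)

⊗-assoc : ∀ {n} (A B C : Matrix n) i j → ((A ⊗ B) ⊗ C) i j ≡ (A ⊗ (B ⊗ C)) i j
⊗-assoc A B C i j = begin
  ∑ (λ k → ∑ (λ l → A i l * B l k) * C k j)   ≡⟨ ∑-cong (λ k → ∑-*ʳ (C k j) (λ l → A i l * B l k)) ⟨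
  ∑ (λ k → ∑ (λ l → A i l * B l k * C k j))   ≡⟨ ∑-swap (λ k l → A i l * B l k * C k j) ⟩
  ∑ (λ l → ∑ (λ k → A i l * B l k * C k j))   ≡⟨ ∑-cong (λ l → trans
    (∑-cong (λ k → *-assoc (A i l) (B l k) (C k j)))
    (∑-*ˡ (A i l) (λ k → B l k * C k j))) ⟩
  ∑ (λ l → A i l * ∑ (λ k → B l k * C k j))   ∎

-- Kernels and inverses of matrices over ℚ

-- Elimination by induction on the number of rows. If the first column vanishes, the first basis
-- vector lies in the kernel. Otherwise a pivot clears the first column from the other rows, and a
-- kernel vector of that smaller system, which again has one unknown more than equations, extends to
-- the whole one.
nontrivialKernel : ∀ m (A : Fin m → Fin (suc m) → ℚ) →
  Σ (Fin (suc m) → ℚ) λ x → (∀ i → ∑ (λ j → A i j * x j) ≡ 0ℚ) × ∃ λ j → x j ≢ 0ℚ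
nontrivialKernel zero A = (λ _ → 1ℚ) , (λ ()) , zero , λ ()
nontrivialKernel (suc m) A with all? (λ i → A i zero ≟ℚ 0ℚ)
... | yes A₀≡0 = e , Ae≡0 , zero , λ ()
  where
  e : Fin (suc (suc m)) → ℚ
  e j = identity j zero
  Ae≡0 : ∀ i → ∑ (λ j → A i j * e j) ≡ 0ℚ
  Ae≡0 i = trans (∑-*-identity (A i) zero) (A₀≡0 i)
... | no ¬A₀≡0 = x , Ax≡0 , suc l , λ xₗ≡0 → yₗ≢0 (x*y≡0⇒y≡0 p≢0 xₗ≡0)
  where
  pivot : ∃ λ r → A r zero ≢ 0ℚ
  pivot = ¬∀⟶∃¬ _ _ (λ i → A i zero ≟ℚ 0ℚ) ¬A₀≡0
  r = proj₁ pivot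
  p = A r zero
  p≢0 : p ≢ 0ℚ
  p≢0 = proj₂ pivot
  -- Each other row times the pivot, minus its first entry times row `r`: the first column cancels
  -- without any division.
  A′ : Fin m → Fin (suc m) → ℚ
  A′ i j = p * A (punchIn r i) (suc j) - A (punchIn r i) zero * A r (suc j)
  IH = nontrivialKernel m A′
  y = proj₁ IH
  l = proj₁ (proj₂ (proj₂ IH))
  yₗ≢0 : y l ≢ 0ℚ
  yₗ≢0 = proj₂ (proj₂ (proj₂ IH))
  s : Fin (suc m) → ℚ
  s i = ∑ (λ j → A i (suc j) * y j)
  x : Fin (suc (suc m)) → ℚ
  -- Scaling `y` by the pivot solves row `r` without division: its value is `p * - s r + p * s r`.
  x zero    = - s r
  x (suc j) = p * y j
  Ax : ∀ i → ∑ (λ j → A i j * x j) ≡ p * s i - A i zero * s r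
  Ax i = begin
    A i zero * - s r + ∑ (λ j → A i (suc j) * (p * y j))
      ≡⟨ cong (A i zero * - s r +_) (trans
           (∑-cong (λ j → solve 3 (λ a p y → a :* (p :* y) := p :* (a :* y)) refl (A i (suc j)) p (y j)))
           (∑-*ˡ p (λ j → A i (suc j) * y j))) ⟩
    A i zero * - s r + p * s i
      ≡⟨ solve 3 (λ a b c → a :* (:- b) :+ c := c :- a :* b) refl (A i zero) (s r) (p * s i) ⟩
    p * s i - A i zero * s r ∎
  A′y : ∀ i → ∑ (λ j → A′ i j * y j) ≡ p * s (punchIn r i) - A (punchIn r i) zero * s r
  A′y i = begin
    ∑ (λ j → A′ i j * y j)
      ≡⟨ ∑-cong (λ j → solve 5 (λ p a b c y → (p :* a :- b :* c) :* y := p :* (a :* y) :- b :* (c :* y)) refl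
                   p (A (punchIn r i) (suc j)) (A (punchIn r i) zero) (A r (suc j)) (y j)) ⟩
    ∑ (λ j → p * (A (punchIn r i) (suc j) * y j) - A (punchIn r i) zero * (A r (suc j) * y j))
      ≡⟨ ∑-sub (λ j → p * (A (punchIn r i) (suc j) * y j)) (λ j → A (punchIn r i) zero * (A r (suc j) * y j)) ⟩
    ∑ (λ j → p * (A (punchIn r i) (suc j) * y j)) - ∑ (λ j → A (punchIn r i) zero * (A r (suc j) * y j))
      ≡⟨ cong₂ _-_ (∑-*ˡ p (λ j → A (punchIn r i) (suc j) * y j)) (∑-*ˡ (A (punchIn r i) zero) (λ j → A r (suc j) * y j)) ⟩
    p * s (punchIn r i) - A (punchIn r i) zero * s r ∎
  Ax≡0 : ∀ i → ∑ (λ j → A i j * x j) ≡ 0ℚ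
  Ax≡0 i with r ≟ i
  ... | yes refl = trans (Ax i) (+-inverseʳ (p * s r))
  ... | no r≢i   = subst (λ k → ∑ (λ j → A k j * x j) ≡ 0ℚ) (punchIn-punchOut r≢i)
                     (trans (Ax _) (trans (sym (A′y (punchOut r≢i))) (proj₁ (proj₂ IH) (punchOut r≢i))))

Injective : ∀ {n} → Matrix n → Set
Injective {n} P = ∀ (x : Fin n → ℚ) → (∀ i → ∑ (λ j → P i j * x j) ≡ 0ℚ) → ∀ j → x j ≡ 0ℚ

-- The matrix P with the extra column -eₖ in front has a nontrivial kernel vector x. Injectivity
-- forces `x zero` to be nonzero, and division by it yields a preimage of eₖ. These preimages form a
-- right inverse Q; it is also a left inverse because P (QP - I) = 0 and P is injective.
injective⇒invertible : ∀ {n} (P : Matrix n) → Injective P →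
  Σ (Matrix n) λ Q → (∀ i j → (Q ⊗ P) i j ≡ identity i j) × (∀ i j → (P ⊗ Q) i j ≡ identity i j)
injective⇒invertible {n} P inj = Q , QP≡I , PQ≡I
  where
  preimage : ∀ k → Σ (Fin n → ℚ) λ q → ∀ i → ∑ (λ j → P i j * q j) ≡ identity i k
  preimage k with nontrivialKernel n (λ { i zero → - identity i k ; i (suc j) → P i j })
  ... | x , Ax≡0 , l , xₗ≢0 with x zero ≟ℚ 0ℚ
  ... | yes x₀≡0 = contradiction (x≡0 l) xₗ≢0
    where
    x≡0 : ∀ j → x j ≡ 0ℚ
    x≡0 zero    = x₀≡0
    x≡0 (suc j) = inj (x ∘ suc) (λ i → begin
      ∑ (λ j → P i j * x (suc j)) ≡⟨ solve 2 (λ a s → s := a :* con 0ℚ :+ s) refl (- identity i k) (∑ (λ j → P i j * x (suc j))) ⟩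
      - identity i k * 0ℚ + ∑ (λ j → P i j * x (suc j))
                                  ≡⟨ cong (λ x₀ → - identity i k * x₀ + ∑ (λ j → P i j * x (suc j))) x₀≡0 ⟨
      - identity i k * x zero + ∑ (λ j → P i j * x (suc j))
                                  ≡⟨ Ax≡0 i ⟩
      0ℚ ∎) j
  ... | no x₀≢0 = (λ j → x (suc j) * 1/ x zero) , λ i → begin
      ∑ (λ j → P i j * (x (suc j) * 1/ x zero)) ≡⟨ ∑-cong (λ j → *-assoc (P i j) (x (suc j)) (1/ x zero)) ⟨
      ∑ (λ j → P i j * x (suc j) * 1/ x zero)   ≡⟨ ∑-*ʳ (1/ x zero) (λ j → P i j * x (suc j)) ⟩
      ∑ (λ j → P i j * x (suc j)) * 1/ x zero   ≡⟨ cong (_* 1/ x zero) (Px i) ⟩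
      identity i k * x zero * 1/ x zero         ≡⟨ solve 3 (λ a b c → a :* b :* c := a :* (c :* b)) refl (identity i k) (x zero) (1/ x zero) ⟩
      identity i k * (1/ x zero * x zero)       ≡⟨ cong (identity i k *_) (*-inverseˡ (x zero)) ⟩
      identity i k * 1ℚ                         ≡⟨ *-identityʳ (identity i k) ⟩
      identity i k                              ∎
    where
    instance _ = ≢-nonZero x₀≢0
    Px : ∀ i → ∑ (λ j → P i j * x (suc j)) ≡ identity i k * x zero
    Px i = x∙y⁻¹≈ε⇒x≈y _ _ (trans
      (solve 3 (λ s a b → s :- a :* b := (:- a) :* b :+ s) refl (∑ (λ j → P i j * x (suc j))) (identity i k) (x zero))
      (Ax≡0 i))
  Q : Matrix n
  Q j k = proj₁ (preimage k) j
  PQ≡I : ∀ i j → (P ⊗ Q) i j ≡ identity i j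
  PQ≡I i k = proj₂ (preimage k) i
  QP≡I : ∀ i j → (Q ⊗ P) i j ≡ identity i j
  QP≡I j k = x∙y⁻¹≈ε⇒x≈y _ _ (inj (λ j → (Q ⊗ P) j k - identity j k) (λ i → begin
    ∑ (λ j → P i j * ((Q ⊗ P) j k - identity j k))
      ≡⟨ ∑-cong (λ j → solve 3 (λ a b c → a :* (b :- c) := a :* b :- a :* c) refl (P i j) ((Q ⊗ P) j k) (identity j k)) ⟩
    ∑ (λ j → P i j * (Q ⊗ P) j k - P i j * identity j k)
      ≡⟨ ∑-sub (λ j → P i j * (Q ⊗ P) j k) (λ j → P i j * identity j k) ⟩
    (P ⊗ (Q ⊗ P)) i k - (P ⊗ identity) i k
      ≡⟨ cong₂ _-_ (sym (⊗-assoc P Q P i k)) (∑-*-identity (P i) k) ⟩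
    ((P ⊗ Q) ⊗ P) i k - P i k
      ≡⟨ cong (_- P i k) (trans (∑-cong (λ l → cong (_* P l k) (PQ≡I i l))) (∑-identity-* (λ l → P l k) i)) ⟩
    P i k - P i k
      ≡⟨ +-inverseʳ (P i k) ⟩
    0ℚ ∎) j)

-- Natural numbers inside ℚ

·-nonNegative : ∀ n → NonNegative (n · 1ℚ)
·-nonNegative zero    = _
·-nonNegative (suc n) = nonNeg+nonNeg⇒nonNeg 1ℚ (n · 1ℚ)
  where instance _ = ·-nonNegative n

suc·1≢0 : ∀ n → suc n · 1ℚ ≢ 0ℚ
suc·1≢0 n eq = <-irrefl (sym eq) (positive⁻¹ (suc n · 1ℚ))
  where instance
    _ = ·-nonNegative n
    _ = pos+nonNeg⇒pos 1ℚ (n · 1ℚ)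

-- Characteristic zero. It reads an identity between sums of rationals back into ℕ, where it becomes
-- a divisibility.
·1-injective : ∀ m n → m · 1ℚ ≡ n · 1ℚ → m ≡ n
·1-injective zero    zero    eq = refl
·1-injective zero    (suc n) eq = contradiction (sym eq) (suc·1≢0 n)
·1-injective (suc m) zero    eq = contradiction eq (suc·1≢0 m)
·1-injective (suc m) (suc n) eq = cong suc (·1-injective m n (begin
  m · 1ℚ               ≡⟨ solve 1 (λ x → x := con (- 1ℚ) :+ (con 1ℚ :+ x)) refl (m · 1ℚ) ⟩
  - 1ℚ + (suc m · 1ℚ)  ≡⟨ cong (- 1ℚ +_) eq ⟩
  - 1ℚ + (suc n · 1ℚ)  ≡⟨ solve 1 (λ x → x := con (- 1ℚ) :+ (con 1ℚ :+ x)) refl (n · 1ℚ) ⟨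
  n · 1ℚ               ∎))

·≡·1* : ∀ n x → n · x ≡ n · 1ℚ * x
·≡·1* n x = sym (trans (Mult.×-assoc-* n 1ℚ x) (cong (n ·_) (*-identityˡ x)))

-- Eigenvectors of the Laplacian of Kₙ

column : ∀ {n} → Matrix n → Fin n → Fin n → ℚ
column P j i = P i j

Balanced : ∀ {n} → (Fin n → ℚ) → Set
Balanced u = ∑ u ≡ 0ℚ

Constant : ∀ {n} → (Fin n → ℚ) → Set
Constant {n} u = ∀ (i i′ : Fin n) → u i ≡ u i′

laplacian-complete : ∀ n (i j : Fin n) →
  laplacian (completeGraph n) i j ≡ n · 1ℚ * identity i j - 1ℚ
laplacian-complete n i j = begin
  (if ⌊ i ≟ j ⌋ then d else 0ℚ) - b2ℚ (not ⌊ i ≟ j ⌋)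
    ≡⟨ cong₂ _-_ (if≡* ⌊ i ≟ j ⌋ d) (b2ℚ-not ⌊ i ≟ j ⌋) ⟩
  d * identity i j - (1ℚ - identity i j)
    ≡⟨ cong (λ d → d * identity i j - (1ℚ - identity i j)) degree ⟩
  (n · 1ℚ - 1ℚ) * identity i j - (1ℚ - identity i j)
    ≡⟨ solve 2 (λ n e → (n :- con 1ℚ) :* e :- (con 1ℚ :- e) := n :* e :- con 1ℚ) refl (n · 1ℚ) (identity i j) ⟩
  n · 1ℚ * identity i j - 1ℚ ∎
  where
  if≡* : ∀ b x → (if b then x else 0ℚ) ≡ x * (if b then 1ℚ else 0ℚ)
  if≡* true  x = sym (*-identityʳ x)
  if≡* false x = sym (*-zeroʳ x)
  b2ℚ-not : ∀ b → b2ℚ (not b) ≡ 1ℚ - (if b then 1ℚ else 0ℚ)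
  b2ℚ-not true  = refl
  b2ℚ-not false = refl
  d = ∑ (λ k → b2ℚ (not ⌊ i ≟ k ⌋))
  degree : d ≡ n · 1ℚ - 1ℚ
  degree = begin
    ∑ (λ k → b2ℚ (not ⌊ i ≟ k ⌋))       ≡⟨ ∑-cong (λ k → trans (b2ℚ-not ⌊ i ≟ k ⌋) (cong (λ e → 1ℚ - e) (identity-sym i k))) ⟩
    ∑ (λ k → 1ℚ - identity k i)         ≡⟨ ∑-sub (λ _ → 1ℚ) (λ k → identity k i) ⟩
    ∑ {n} (λ _ → 1ℚ) - ∑ (λ k → identity k i) ≡⟨ cong₂ _-_ (∑-const n 1ℚ) (∑-identity i) ⟩
    n · 1ℚ - 1ℚ                         ∎

laplacian-complete-⊗ : ∀ {n} (P : Matrix n) i j →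
  (laplacian (completeGraph n) ⊗ P) i j ≡ n · 1ℚ * P i j - ∑ (column P j)
laplacian-complete-⊗ {n} P i j = begin
  ∑ (λ k → laplacian (completeGraph n) i k * P k j)
    ≡⟨ ∑-cong (λ k → cong (_* P k j) (laplacian-complete n i k)) ⟩
  ∑ (λ k → (n · 1ℚ * identity i k - 1ℚ) * P k j)
    ≡⟨ ∑-cong (λ k → solve 3 (λ n e p → (n :* e :- con 1ℚ) :* p := n :* (e :* p) :- p) refl (n · 1ℚ) (identity i k) (P k j)) ⟩
  ∑ (λ k → n · 1ℚ * (identity i k * P k j) - P k j)
    ≡⟨ ∑-sub (λ k → n · 1ℚ * (identity i k * P k j)) (column P j) ⟩
  ∑ (λ k → n · 1ℚ * (identity i k * P k j)) - ∑ (column P j)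
    ≡⟨ cong (_- ∑ (column P j)) (trans (∑-*ˡ (n · 1ℚ) (λ k → identity i k * P k j)) (cong (n · 1ℚ *_) (∑-identity-* (column P j) i))) ⟩
  n · 1ℚ * P i j - ∑ (column P j) ∎

-- The eigenvectors of the Laplacian n I − J of Kₙ, for the eigenvalues n and 0.
Eigen : ∀ {n} → (Fin n → ℚ) → Set
Eigen u = Balanced u ⊎ Constant u

-- The left side is the i-th entry of the Laplacian applied to u. It is n uᵢ when the sum vanishes,
-- and 0 when u is constant, since the sum is then n uᵢ.
eigenvalue : ∀ {n} (u : Fin n → ℚ) → Eigen u → ∃ λ d → ∀ i → n · 1ℚ * u i - ∑ u ≡ u i * d
eigenvalue {n} u (inj₁ ∑u≡0) = n · 1ℚ , λ i → begin
  n · 1ℚ * u i - ∑ u ≡⟨ cong (λ s → n · 1ℚ * u i - s) ∑u≡0 ⟩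
  n · 1ℚ * u i - 0ℚ  ≡⟨ solve 2 (λ n u → n :* u :- con 0ℚ := u :* n) refl (n · 1ℚ) (u i) ⟩
  u i * (n · 1ℚ)     ∎
eigenvalue {n} u (inj₂ const) = 0ℚ , λ i → begin
  n · 1ℚ * u i - ∑ u            ≡⟨ cong (λ s → n · 1ℚ * u i - s) (trans (∑-cong (λ k → const k i)) (∑-const n (u i))) ⟩
  n · 1ℚ * u i - n · u i        ≡⟨ cong (λ s → n · 1ℚ * u i - s) (·≡·1* n (u i)) ⟩
  n · 1ℚ * u i - n · 1ℚ * u i   ≡⟨ +-inverseʳ (n · 1ℚ * u i) ⟩
  0ℚ                            ≡⟨ *-zeroʳ (u i) ⟨
  u i * 0ℚ                      ∎

-- Rewritten, (n - d) uᵢ is the same number `∑ u` for every i. When that number is nonzero, so is n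
-- - d, and cancelling it makes all entries equal.
eigenvector : ∀ {n} (u : Fin n → ℚ) d → (∀ i → n · 1ℚ * u i - ∑ u ≡ u i * d) → Eigen u
eigenvector {n} u d Lu≡du with ∑ u ≟ℚ 0ℚ
... | yes ∑u≡0 = inj₁ ∑u≡0
... | no ∑u≢0  = inj₂ λ i i′ → x∙y⁻¹≈ε⇒x≈y (u i) (u i′) (x*y≡0⇒y≡0 (n-d≢0 i) (begin
    (n · 1ℚ - d) * (u i - u i′)              ≡⟨ solve 3 (λ c a b → c :* (a :- b) := c :* a :- c :* b) refl (n · 1ℚ - d) (u i) (u i′) ⟩
    (n · 1ℚ - d) * u i - (n · 1ℚ - d) * u i′ ≡⟨ cong₂ _-_ (shifted i) (shifted i′) ⟩
    ∑ u - ∑ u                                ≡⟨ +-inverseʳ (∑ u) ⟩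
    0ℚ                                       ∎))
  where
  shifted : ∀ i → (n · 1ℚ - d) * u i ≡ ∑ u
  shifted i = begin
    (n · 1ℚ - d) * u i
      ≡⟨ solve 4 (λ n d u s → (n :- d) :* u := (n :* u :- s) :- u :* d :+ s) refl (n · 1ℚ) d (u i) (∑ u) ⟩
    (n · 1ℚ * u i - ∑ u) - u i * d + ∑ u
      ≡⟨ cong (λ x → x - u i * d + ∑ u) (Lu≡du i) ⟩
    u i * d - u i * d + ∑ u
      ≡⟨ solve 2 (λ a s → a :- a :+ s := s) refl (u i * d) (∑ u) ⟩
    ∑ u ∎
  n-d≢0 : Fin n → n · 1ℚ - d ≢ 0ℚ
  n-d≢0 i n-d≡0 = ∑u≢0 (trans (sym (shifted i)) (trans (cong (_* u i) n-d≡0) (*-zeroˡ (u i))))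

-- Eigenvector columns give LP = P diag(d), so QLP = (QP) diag(d) is diagonal for the inverse Q that
-- injectivity provides.
diagonalizes-complete : ∀ {n} (S : Subset) (P : Matrix n) → EntriesIn S P → Injective P →
  (∀ j → Eigen (column P j)) → Diagonalizes S (completeGraph n) P
diagonalizes-complete {n} S P entries inj eigen =
  entries , Q , QP≡I , proj₂ (proj₂ inverse) , λ i j i≢j → begin
    (Q ⊗ L ⊗ P) i j                 ≡⟨ ⊗-assoc Q L P i j ⟩
    ∑ (λ k → Q i k * (L ⊗ P) k j)   ≡⟨ ∑-cong (λ k → cong (Q i k *_) (LP k j)) ⟩
    ∑ (λ k → Q i k * (P k j * d j)) ≡⟨ ∑-cong (λ k → *-assoc (Q i k) (P k j) (d j)) ⟨
    ∑ (λ k → Q i k * P k j * d j)   ≡⟨ ∑-*ʳ (d j) (λ k → Q i k * P k j) ⟩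
    (Q ⊗ P) i j * d j               ≡⟨ cong (_* d j) (trans (QP≡I i j) (identity-off i≢j)) ⟩
    0ℚ * d j                        ≡⟨ *-zeroˡ (d j) ⟩
    0ℚ                              ∎
  where
  L = laplacian (completeGraph n)
  inverse = injective⇒invertible P inj
  Q = proj₁ inverse
  QP≡I = proj₁ (proj₂ inverse)
  d : Fin n → ℚ
  d j = proj₁ (eigenvalue (column P j) (eigen j))
  LP : ∀ i j → (L ⊗ P) i j ≡ P i j * d j
  LP i j = trans (laplacian-complete-⊗ P i j) (proj₂ (eigenvalue (column P j) (eigen j)) i)

diagonalizes⇒injective : ∀ {n} (S : Subset) (G : Graph n) {P : Matrix n} →
  Diagonalizes S G P → Injective P
diagonalizes⇒injective {n} S G {P} (_ , Q , QP≡I , _) x Px≡0 k = begin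
  x k                           ≡⟨ ∑-identity-* x k ⟨
  ∑ (λ j → identity k j * x j)  ≡⟨ ∑-cong (λ j → cong (_* x j) (QP≡I k j)) ⟨
  (Q ⊗ P ⊗ X) k k               ≡⟨ ⊗-assoc Q P X k k ⟩
  ∑ (λ i → Q k i * (P ⊗ X) i k) ≡⟨ ∑-0 (λ i → trans (cong (Q k i *_) (Px≡0 i)) (*-zeroʳ (Q k i))) ⟩
  0ℚ                            ∎
  where
  -- The vector `x` repeated in every column, so that `⊗-assoc` applies to it.
  X : Matrix n
  X i _ = x i

-- With D = QLP diagonal and PQ = I one has LP = PD, so column j of P belongs to the eigenvalue
-- `D j j`.
diagonalizes-complete⇒eigen : ∀ {n} (S : Subset) {P : Matrix n} →
  Diagonalizes S (completeGraph n) P → ∀ j → Eigen (column P j)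
diagonalizes-complete⇒eigen {n} S {P} (_ , Q , _ , PQ≡I , diagonal) j =
  eigenvector (column P j) (D j j) λ i → begin
    n · 1ℚ * P i j - ∑ (column P j) ≡⟨ laplacian-complete-⊗ P i j ⟨
    (L ⊗ P) i j                     ≡⟨ ∑-identity-* (λ k → (L ⊗ P) k j) i ⟨
    ∑ (λ k → identity i k * (L ⊗ P) k j) ≡⟨ ∑-cong (λ k → cong (_* (L ⊗ P) k j) (PQ≡I i k)) ⟨
    (P ⊗ Q ⊗ (L ⊗ P)) i j           ≡⟨ ⊗-assoc P Q (L ⊗ P) i j ⟩
    (P ⊗ (Q ⊗ (L ⊗ P))) i j         ≡⟨ ∑-cong (λ k → cong (P i k *_) (⊗-assoc Q L P k j)) ⟨
    (P ⊗ D) i j                     ≡⟨ ∑-single j (λ k k≢j → trans (cong (P i k *_) (diagonal k j k≢j)) (*-zeroʳ (P i k))) ⟩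
    P i j * D j j                   ∎
  where
  L = laplacian (completeGraph n)
  D = Q ⊗ L ⊗ P

-- Divisibility from balanced sign vectors

∑-multiple : ∀ {n} c (f : Fin n → ℚ) → (∀ i → f i ≡ 0ℚ ⊎ f i ≡ c) → ∃ λ a → ∑ f ≡ a · c
∑-multiple {zero}  c f f∈ = 0 , refl
∑-multiple {suc n} c f f∈ with f∈ zero | ∑-multiple c (f ∘ suc) (f∈ ∘ suc)
... | inj₁ f₀≡0 | a , eq = a , trans (cong₂ _+_ f₀≡0 eq) (+-identityˡ (a · c))
... | inj₂ f₀≡c | a , eq = suc a , cong₂ _+_ f₀≡c eq

-- If a of the terms equal c, the sum is a c. The comparison with n takes place in ℚ and is carried
-- to ℕ by `·1-injective`.
∣-from-∑ : ∀ {n} c (f : Fin n → ℚ) → (∀ i → f i ≡ 0ℚ ⊎ f i ≡ c · 1ℚ) → ∑ f ≡ n · 1ℚ → c ∣ n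
∣-from-∑ {n} c f f∈ ∑f≡n with ∑-multiple (c · 1ℚ) f f∈
... | a , eq = divides a (·1-injective n (a ℕ.* c)
                 (trans (sym ∑f≡n) (trans eq (Mult.×-assocˡ 1ℚ a c))))

balanced⇒2∣n : ∀ {n} (u : Fin n → ℚ) → (∀ i → S₋₁₁ (u i)) → Balanced u → 2 ∣ n
balanced⇒2∣n {n} u u∈ ∑u≡0 = ∣-from-∑ 2 (λ i → 1ℚ + u i) (λ i → values (u∈ i)) (begin
  ∑ (λ i → 1ℚ + u i)     ≡⟨ ∑-+ (λ _ → 1ℚ) u ⟩
  ∑ {n} (λ _ → 1ℚ) + ∑ u ≡⟨ cong₂ _+_ (∑-const n 1ℚ) ∑u≡0 ⟩
  n · 1ℚ + 0ℚ            ≡⟨ +-identityʳ (n · 1ℚ) ⟩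
  n · 1ℚ                 ∎)
  where
  values : ∀ {x} → S₋₁₁ x → 1ℚ + x ≡ 0ℚ ⊎ 1ℚ + x ≡ 2 · 1ℚ
  values (inj₁ refl) = inj₁ refl
  values (inj₂ refl) = inj₂ refl

balanced-orthogonal⇒4∣n : ∀ {n} (u v : Fin n → ℚ) → (∀ i → S₋₁₁ (u i)) → (∀ i → S₋₁₁ (v i)) →
  Balanced u → Balanced v → ∑ (λ i → u i * v i) ≡ 0ℚ → 4 ∣ n
balanced-orthogonal⇒4∣n {n} u v u∈ v∈ ∑u≡0 ∑v≡0 u⊥v =
  ∣-from-∑ 4 (λ i → (1ℚ + u i) * (1ℚ + v i)) (λ i → values (u∈ i) (v∈ i)) (begin
    ∑ (λ i → (1ℚ + u i) * (1ℚ + v i))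
      ≡⟨ ∑-cong (λ i → solve 2 (λ u v → (con 1ℚ :+ u) :* (con 1ℚ :+ v) := con 1ℚ :+ u :+ v :+ u :* v) refl (u i) (v i)) ⟩
    ∑ (λ i → 1ℚ + u i + v i + u i * v i)
      ≡⟨ trans (∑-+ (λ i → 1ℚ + u i + v i) (λ i → u i * v i))
        (cong (_+ ∑ (λ i → u i * v i)) (trans (∑-+ (λ i → 1ℚ + u i) v) (cong (_+ ∑ v) (∑-+ (λ _ → 1ℚ) u)))) ⟩
    ∑ {n} (λ _ → 1ℚ) + ∑ u + ∑ v + ∑ (λ i → u i * v i)
      ≡⟨ cong₂ _+_ (cong₂ _+_ (cong₂ _+_ (∑-const n 1ℚ) ∑u≡0) ∑v≡0) u⊥v ⟩
    n · 1ℚ + 0ℚ + 0ℚ + 0ℚ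
      ≡⟨ solve 1 (λ x → x :+ con 0ℚ :+ con 0ℚ :+ con 0ℚ := x) refl (n · 1ℚ) ⟩
    n · 1ℚ ∎)
  where
  values : ∀ {x y} → S₋₁₁ x → S₋₁₁ y →
    (1ℚ + x) * (1ℚ + y) ≡ 0ℚ ⊎ (1ℚ + x) * (1ℚ + y) ≡ 4 · 1ℚ
  values (inj₁ refl) (inj₁ refl) = inj₁ refl
  values (inj₁ refl) (inj₂ refl) = inj₁ refl
  values (inj₂ refl) (inj₁ refl) = inj₁ refl
  values (inj₂ refl) (inj₂ refl) = inj₂ refl

S₋₁₁⇒≢0 : ∀ {x} → S₋₁₁ x → x ≢ 0ℚ
S₋₁₁⇒≢0 (inj₁ refl) ()
S₋₁₁⇒≢0 (inj₂ refl) ()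

-- Two constant columns are proportional, so for distinct j and j′ the combination of eⱼ and eⱼ′
-- with coefficients `P j j′` and `- P j j` lies in the kernel, yet its j-th coordinate is ±1.
constantColumn-unique : ∀ {n} {P : Matrix n} → EntriesIn S₋₁₁ P → Injective P → ∀ {j j′} →
  Constant (column P j) → Constant (column P j′) → j ≡ j′
constantColumn-unique {n} {P} entries inj {j} {j′} cⱼ cⱼ′ with j ≟ j′
... | yes j≡j′ = j≡j′
... | no j≢j′  = contradiction (trans (sym xⱼ) (inj x Px≡0 j)) (S₋₁₁⇒≢0 (entries j j′))
  where
  x : Fin n → ℚ
  x k = P j j′ * identity k j - P j j * identity k j′
  xⱼ : x j ≡ P j j′
  xⱼ = begin
    P j j′ * identity j j - P j j * identity j j′ ≡⟨ cong₂ (λ a b → P j j′ * a - P j j * b) (identity-diag j) (identity-off j≢j′) ⟩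
    P j j′ * 1ℚ - P j j * 0ℚ                      ≡⟨ solve 2 (λ a b → a :* con 1ℚ :- b :* con 0ℚ := a) refl (P j j′) (P j j) ⟩
    P j j′                                        ∎
  Px≡0 : ∀ i → ∑ (λ k → P i k * x k) ≡ 0ℚ
  Px≡0 i = begin
    ∑ (λ k → P i k * x k)
      ≡⟨ ∑-cong (λ k → solve 5 (λ p a e b f → p :* (a :* e :- b :* f) := a :* (p :* e) :- b :* (p :* f)) refl
                  (P i k) (P j j′) (identity k j) (P j j) (identity k j′)) ⟩
    ∑ (λ k → P j j′ * (P i k * identity k j) - P j j * (P i k * identity k j′))
      ≡⟨ ∑-sub (λ k → P j j′ * (P i k * identity k j)) (λ k → P j j * (P i k * identity k j′)) ⟩
    ∑ (λ k → P j j′ * (P i k * identity k j)) - ∑ (λ k → P j j * (P i k * identity k j′))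
      ≡⟨ cong₂ _-_ (trans (∑-*ˡ (P j j′) (λ k → P i k * identity k j)) (cong (P j j′ *_) (∑-*-identity (P i) j)))
                   (trans (∑-*ˡ (P j j) (λ k → P i k * identity k j′)) (cong (P j j *_) (∑-*-identity (P i) j′))) ⟩
    P j j′ * P i j - P j j * P i j′
      ≡⟨ cong₂ (λ a b → P j j′ * a - P j j * b) (cⱼ i j) (cⱼ′ i j) ⟩
    P j j′ * P j j - P j j * P j j′
      ≡⟨ solve 2 (λ a b → a :* b :- b :* a := con 0ℚ) refl (P j j′) (P j j) ⟩
    0ℚ ∎

-- Criteria for injectivity

-- Pairing Px = 0 with the all-ones vector weights each coordinate of x by its column sum. Only the
-- first column has a nonzero sum, namely m + 1.
firstCoordinate≡0 : ∀ {m} (P : Matrix (suc m)) → (∀ i → P i zero ≡ 1ℚ) →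
  (∀ j → Balanced (column P (suc j))) →
  ∀ (x : Fin (suc m) → ℚ) → (∀ i → ∑ (λ j → P i j * x j) ≡ 0ℚ) → x zero ≡ 0ℚ
firstCoordinate≡0 {m} P P₀≡1 balanced x Px≡0 = x*y≡0⇒y≡0 (suc·1≢0 m) (begin
  suc m · 1ℚ * x zero
    ≡⟨ cong (_* x zero) (trans (∑-cong P₀≡1) (∑-const (suc m) 1ℚ)) ⟨
  ∑ (column P zero) * x zero
    ≡⟨ ∑-single {f = λ j → ∑ (column P j) * x j} zero (λ { zero 0≢0 → contradiction refl 0≢0
                        ; (suc j) _ → trans (cong (_* x (suc j)) (balanced j)) (*-zeroˡ (x (suc j))) }) ⟨
  ∑ (λ j → ∑ (column P j) * x j)
    ≡⟨ ∑-cong (λ j → ∑-*ʳ (x j) (column P j)) ⟨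
  ∑ (λ j → ∑ (λ i → P i j * x j))
    ≡⟨ ∑-swap (λ j i → P i j * x j) ⟩
  ∑ (λ i → ∑ (λ j → P i j * x j))
    ≡⟨ ∑-0 Px≡0 ⟩
  0ℚ ∎)

-- Forward substitution: the first row kills the first coordinate, and deleting the first row and
-- column leaves a smaller triangular system.
lowerTriangular-injective : ∀ {n} (T : Matrix n) → (∀ {i j} → i Fin.< j → T i j ≡ 0ℚ) →
  (∀ i → T i i ≢ 0ℚ) → Injective T
lowerTriangular-injective {suc n} T upper≡0 diag≢0 x Tx≡0 = x≡0
  where
  x₀≡0 : x zero ≡ 0ℚ
  x₀≡0 = x*y≡0⇒y≡0 (diag≢0 zero) (trans
    (sym (∑-single {f = λ j → T zero j * x j} zero (λ { zero 0≢0 → contradiction refl 0≢0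
                           ; (suc j) _ → trans (cong (_* x (suc j)) (upper≡0 (s≤s z≤n))) (*-zeroˡ (x (suc j))) })))
    (Tx≡0 zero))
  T′x≡0 : ∀ i → ∑ (λ j → T (suc i) (suc j) * x (suc j)) ≡ 0ℚ
  T′x≡0 i = begin
    ∑ (λ j → T (suc i) (suc j) * x (suc j))
      ≡⟨ solve 2 (λ t s → s := t :* con 0ℚ :+ s) refl (T (suc i) zero) (∑ (λ j → T (suc i) (suc j) * x (suc j))) ⟩
    T (suc i) zero * 0ℚ + ∑ (λ j → T (suc i) (suc j) * x (suc j))
      ≡⟨ cong (λ x₀ → T (suc i) zero * x₀ + ∑ (λ j → T (suc i) (suc j) * x (suc j))) x₀≡0 ⟨
    ∑ (λ j → T (suc i) j * x j)
      ≡⟨ Tx≡0 (suc i) ⟩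
    0ℚ ∎
  x≡0 : ∀ j → x j ≡ 0ℚ
  x≡0 zero    = x₀≡0
  x≡0 (suc j) = lowerTriangular-injective (λ i j → T (suc i) (suc j)) (λ i<j → upper≡0 (s≤s i<j))
                  (λ i → diag≢0 (suc i)) (x ∘ suc) T′x≡0 j

-- Adjacent differences: an eigenbasis of bandwidth at most 2

dist>0⇒≢ : ∀ {n} {i j : Fin n} → 1 ℕ.≤ dist i j → i ≢ j
dist>0⇒≢ {i = i} 1≤d refl = ℕ.<⇒≢ 1≤d (sym (cong₂ ℕ._+_ (ℕ.n∸n≡0 (toℕ i)) (ℕ.n∸n≡0 (toℕ i))))

inject₁≢suc : ∀ {m} {i j : Fin m} → i Fin.≤ j → inject₁ i ≢ suc j
inject₁≢suc {i = i} i≤j eq = ℕ.<⇒≢ (s≤s i≤j) (trans (sym (toℕ-inject₁ i)) (cong toℕ eq))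

-- The columns after the first are the simple roots of type A, so the Gram matrix is the entry m + 1
-- followed by a block equal to the tridiagonal Cartan matrix.
differences : ∀ m → Matrix (suc m)
differences m i zero    = 1ℚ
differences m i (suc j) = identity i (inject₁ j) - identity i (suc j)

differences-balanced : ∀ {m} (j : Fin m) → Balanced (column (differences m) (suc j))
differences-balanced j = trans (∑-sub (λ i → identity i (inject₁ j)) (λ i → identity i (suc j)))
  (cong₂ _-_ (∑-identity (inject₁ j)) (∑-identity (suc j)))

differences-eigen : ∀ m j → Eigen (column (differences m) j)
differences-eigen m zero    = inj₂ λ _ _ → refl
differences-eigen m (suc j) = inj₁ (differences-balanced j)

identity-values : ∀ {n} (i j : Fin n) → identity i j ≡ 0ℚ ⊎ identity i j ≡ 1ℚ
identity-values i j with i ≟ j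
... | yes _ = inj₂ refl
... | no _  = inj₁ refl

identity≡1⇒≡ : ∀ {n} {i j : Fin n} → identity i j ≡ 1ℚ → i ≡ j
identity≡1⇒≡ {i = i} {j} eq with i ≟ j
... | yes i≡j = i≡j
identity≡1⇒≡ {i = i} {j} () | no _

differences-entries : ∀ m → EntriesIn S₋₁₀₁ (differences m)
differences-entries m i zero = inj₂ (inj₂ refl)
differences-entries m i (suc j) with identity-values i (inject₁ j) | identity-values i (suc j)
... | inj₁ a | inj₁ b = inj₂ (inj₁ (cong₂ _-_ a b))
... | inj₁ a | inj₂ b = inj₁ (cong₂ _-_ a b)
... | inj₂ a | inj₁ b = inj₂ (inj₂ (cong₂ _-_ a b))
... | inj₂ a | inj₂ b = inj₂ (inj₁ (cong₂ _-_ a b))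

-- Balance disposes of the first coordinate. On the first m rows the remaining columns form a lower
-- triangular matrix with diagonal 1, because eⱼ - eⱼ₊₁ starts in row j.
differences-injective : ∀ m → Injective (differences m)
differences-injective m x Px≡0 = x≡0
  where
  x₀≡0 : x zero ≡ 0ℚ
  x₀≡0 = firstCoordinate≡0 (differences m) (λ _ → refl) differences-balanced x Px≡0
  T : Matrix m
  T k j = differences m (inject₁ k) (suc j)
  T-upper : ∀ {k j} → k Fin.< j → T k j ≡ 0ℚ
  T-upper k<j = cong₂ _-_ (identity-off (<⇒≢ k<j ∘ inject₁-injective)) (identity-off (inject₁≢suc (ℕ.<⇒≤ k<j)))
  T-diag : ∀ k → T k k ≢ 0ℚ
  T-diag k Tₖₖ≡0 with () ← trans (sym (cong₂ _-_ (identity-diag (inject₁ k)) (identity-off (inject₁≢suc {i = k} {k} ℕ.≤-refl)))) Tₖₖ≡0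
  Tx≡0 : ∀ k → ∑ (λ j → T k j * x (suc j)) ≡ 0ℚ
  Tx≡0 k = begin
    ∑ (λ j → T k j * x (suc j))          ≡⟨ +-identityˡ _ ⟨
    1ℚ * 0ℚ + ∑ (λ j → T k j * x (suc j)) ≡⟨ cong (λ x₀ → 1ℚ * x₀ + ∑ (λ j → T k j * x (suc j))) x₀≡0 ⟨
    ∑ (λ j → differences m (inject₁ k) j * x j) ≡⟨ Px≡0 (inject₁ k) ⟩
    0ℚ ∎
  x≡0 : ∀ j → x j ≡ 0ℚ
  x≡0 zero    = x₀≡0
  x≡0 (suc j) = lowerTriangular-injective T T-upper T-diag (x ∘ suc) Tx≡0 j

differences-diagonalizes : ∀ m → Diagonalizes S₋₁₀₁ (completeGraph (suc m)) (differences m)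
differences-diagonalizes m = diagonalizes-complete S₋₁₀₁ (differences m)
  (differences-entries m) (differences-injective m) (differences-eigen m)

differences-support : ∀ {m} i (j : Fin m) →
  toℕ i ≢ toℕ j → toℕ i ≢ suc (toℕ j) → differences m i (suc j) ≡ 0ℚ
differences-support i j i≢j i≢1+j = cong₂ _-_
  (identity-off {i = i} {inject₁ j} λ eq → i≢j (trans (cong toℕ eq) (toℕ-inject₁ j)))
  (identity-off {i = i} {suc j} λ eq → i≢1+j (cong toℕ eq))

-- Difference columns at least two places apart have disjoint supports. Stripping successors from a
-- and b together reduces to the case that one of them is zero.
≥2⇒≢ : ∀ {a b i} → 2 ℕ.≤ (a ℕ.∸ b) ℕ.+ (b ℕ.∸ a) → i ≡ a ⊎ i ≡ suc a → i ≢ b × i ≢ suc b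
≥2⇒≢ {zero}  {suc zero} (s≤s ())
≥2⇒≢ {zero}  {suc (suc b)} _ (inj₁ refl) = (λ ()) , (λ ())
≥2⇒≢ {zero}  {suc (suc b)} _ (inj₂ refl) = (λ ()) , (λ ())
≥2⇒≢ {suc zero}    {zero} (s≤s ())
≥2⇒≢ {suc (suc a)} {zero} _ (inj₁ refl) = (λ ()) , (λ ())
≥2⇒≢ {suc (suc a)} {zero} _ (inj₂ refl) = (λ ()) , (λ ())
≥2⇒≢ {suc a} {suc b} 2≤d (inj₁ refl) with ≥2⇒≢ {a} {b} 2≤d (inj₁ refl)
... | p , q = p ∘ ℕ.suc-injective , q ∘ ℕ.suc-injective
≥2⇒≢ {suc a} {suc b} 2≤d (inj₂ refl) with ≥2⇒≢ {a} {b} 2≤d (inj₂ refl)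
... | p , q = p ∘ ℕ.suc-injective , q ∘ ℕ.suc-injective

∑-*1 : ∀ {n} (f : Fin n → ℚ) → ∑ (λ i → f i * 1ℚ) ≡ ∑ f
∑-*1 f = ∑-cong (λ i → *-identityʳ (f i))

∑-1* : ∀ {n} (f : Fin n → ℚ) → ∑ (λ i → 1ℚ * f i) ≡ ∑ f
∑-1* f = ∑-cong (λ i → *-identityˡ (f i))

-- The all-ones column is orthogonal to the others by balance. For two difference columns outside
-- the band every single product vanishes, because the supports are disjoint.
differences-band : ∀ m → ZeroOutsideBand (transpose (differences m) ⊗ differences m) 2
differences-band m zero zero ()
differences-band m zero (suc j) _ = trans (∑-1* (column (differences m) (suc j))) (differences-balanced j)
differences-band m (suc j) zero _ = trans (∑-*1 (column (differences m) (suc j))) (differences-balanced j)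
differences-band m (suc j) (suc j′) 2≤d = ∑-0 λ i → product≡0 i
  where
  product≡0 : ∀ i → differences m i (suc j) * differences m i (suc j′) ≡ 0ℚ
  zeroʳ : ∀ i → toℕ i ≡ toℕ j ⊎ toℕ i ≡ suc (toℕ j) →
    differences m i (suc j) * differences m i (suc j′) ≡ 0ℚ
  zeroʳ i i∈ = trans
    (cong (differences m i (suc j) *_)
      (differences-support i j′ (proj₁ (≥2⇒≢ {toℕ j} {toℕ j′} 2≤d i∈)) (proj₂ (≥2⇒≢ {toℕ j} {toℕ j′} 2≤d i∈))))
    (*-zeroʳ (differences m i (suc j)))
  product≡0 i with toℕ i ℕ.≟ toℕ j | toℕ i ℕ.≟ suc (toℕ j)
  ... | yes eq | _      = zeroʳ i (inj₁ eq)
  ... | no _   | yes eq = zeroʳ i (inj₂ eq)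
  ... | no p   | no q   = trans (cong (_* differences m i (suc j′)) (differences-support i j p q)) (*-zeroˡ (differences m i (suc j′)))

-- Alternating vectors: a ±1 eigenbasis for even n

alternating : ∀ {n} → Fin n → ℚ
alternating zero    = 1ℚ
alternating (suc i) = - alternating i

alternating-inject₁ : ∀ {n} (i : Fin n) → alternating (inject₁ i) ≡ alternating i
alternating-inject₁ zero    = refl
alternating-inject₁ (suc i) = cong -_ (alternating-inject₁ i)

S₋₁₁-neg : ∀ {x} → S₋₁₁ x → S₋₁₁ (- x)
S₋₁₁-neg (inj₁ refl) = inj₂ refl
S₋₁₁-neg (inj₂ refl) = inj₁ refl

S₋₁₁-* : ∀ {x y} → S₋₁₁ x → S₋₁₁ y → S₋₁₁ (x * y)
S₋₁₁-* (inj₁ refl) (inj₁ refl) = inj₂ refl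
S₋₁₁-* (inj₁ refl) (inj₂ refl) = inj₁ refl
S₋₁₁-* (inj₂ refl) (inj₁ refl) = inj₁ refl
S₋₁₁-* (inj₂ refl) (inj₂ refl) = inj₂ refl

alternating∈S₋₁₁ : ∀ {n} (i : Fin n) → S₋₁₁ (alternating i)
alternating∈S₋₁₁ zero    = inj₂ refl
alternating∈S₋₁₁ (suc i) = S₋₁₁-neg (alternating∈S₋₁₁ i)

alternating-balanced : ∀ {n} → 2 ∣ n → Balanced (alternating {n})
alternating-balanced (divides q refl) = go q
  where
  go : ∀ q → ∑ (alternating {q ℕ.* 2}) ≡ 0ℚ
  go zero    = refl
  go (suc q) = begin
    1ℚ + (- 1ℚ + ∑ {q ℕ.* 2} (λ i → - - alternating i)) ≡⟨ solve 1 (λ s → con 1ℚ :+ (con (- 1ℚ) :+ s) := s) refl (∑ {q ℕ.* 2} (λ i → - - alternating i)) ⟩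
    ∑ {q ℕ.* 2} (λ i → - - alternating i) ≡⟨ ∑-cong (λ i → solve 1 (λ x → :- (:- x) := x) refl (alternating {q ℕ.* 2} i)) ⟩
    ∑ {q ℕ.* 2} alternating               ≡⟨ go q ⟩
    0ℚ                                    ∎

-- The indicator of positions j + 1 and j + 2, counted from 0. The alternating vector has opposite
-- signs there, so negating both entries, by the factor 1 - 2 `flips`, amounts to exchanging them.
flips : ∀ {m} → Fin (suc (suc m)) → Fin m → ℚ
flips i j = identity i (suc (inject₁ j)) + identity i (suc (suc j))

-- All-ones, then the alternating vector, then the alternating vector with the
-- signs at the adjacent positions j + 1 and j + 2 exchanged.
exchanges : ∀ m → Matrix (suc (suc m))
exchanges m i zero          = 1ℚ
exchanges m i (suc zero)    = alternating i
exchanges m i (suc (suc j)) = alternating i * (1ℚ - 2 · 1ℚ * flips i j)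

exchanges-entries : ∀ m → EntriesIn S₋₁₁ (exchanges m)
exchanges-entries m i zero          = inj₂ refl
exchanges-entries m i (suc zero)    = alternating∈S₋₁₁ i
exchanges-entries m i (suc (suc j)) = S₋₁₁-* (alternating∈S₋₁₁ i) (sign flips-values)
  where
  sign : ∀ {x} → x ≡ 0ℚ ⊎ x ≡ 1ℚ → S₋₁₁ (1ℚ - 2 · 1ℚ * x)
  sign (inj₁ refl) = inj₂ refl
  sign (inj₂ refl) = inj₁ refl
  flips-values : flips i j ≡ 0ℚ ⊎ flips i j ≡ 1ℚ
  flips-values with identity-values i (suc (inject₁ j)) | identity-values i (suc (suc j))
  ... | inj₁ a≡0 | inj₁ b≡0 = inj₁ (cong₂ _+_ a≡0 b≡0)
  ... | inj₁ a≡0 | inj₂ b≡1 = inj₂ (cong₂ _+_ a≡0 b≡1)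
  ... | inj₂ a≡1 | inj₁ b≡0 = inj₂ (cong₂ _+_ a≡1 b≡0)
  ... | inj₂ a≡1 | inj₂ b≡1 = contradiction
    (suc-injective (trans (sym (identity≡1⇒≡ a≡1)) (identity≡1⇒≡ b≡1))) (inject₁≢suc {i = j} {j} ℕ.≤-refl)

-- Evenness balances the alternating vector w. An exchange alters its sum by -2 times the sum of two
-- neighbouring entries of w, which cancel.
exchanges-balanced : ∀ {m} → 2 ∣ suc (suc m) → ∀ j → Balanced (column (exchanges m) (suc j))
exchanges-balanced     2∣n zero    = alternating-balanced 2∣n
exchanges-balanced {m} 2∣n (suc j) = begin
  ∑ (λ i → w i * (1ℚ - 2 · 1ℚ * flips i j))
    ≡⟨ ∑-cong (λ i → solve 4 (λ w c a b → w :* (con 1ℚ :- c :* (a :+ b)) := w :- c :* (w :* a :+ w :* b)) refl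
                (w i) (2 · 1ℚ) (a i) (b i)) ⟩
  ∑ (λ i → w i - 2 · 1ℚ * (w i * a i + w i * b i))
    ≡⟨ trans (∑-sub w (λ i → 2 · 1ℚ * (w i * a i + w i * b i)))
             (cong (λ s → ∑ w - s) (trans (∑-*ˡ (2 · 1ℚ) (λ i → w i * a i + w i * b i))
                                 (cong (2 · 1ℚ *_) (∑-+ (λ i → w i * a i) (λ i → w i * b i))))) ⟩
  ∑ w - 2 · 1ℚ * (∑ (λ i → w i * a i) + ∑ (λ i → w i * b i))
    ≡⟨ cong₂ (λ s t → s - 2 · 1ℚ * t) (alternating-balanced 2∣n)
         (cong₂ _+_ (∑-*-identity w (suc (inject₁ j))) (∑-*-identity w (suc (suc j)))) ⟩
  0ℚ - 2 · 1ℚ * (- alternating (inject₁ j) + - - alternating j)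
    ≡⟨ cong (λ x → 0ℚ - 2 · 1ℚ * (- x + - - alternating j)) (alternating-inject₁ j) ⟩
  0ℚ - 2 · 1ℚ * (- alternating j + - - alternating j)
    ≡⟨ solve 2 (λ c x → con 0ℚ :- c :* (:- x :+ :- (:- x)) := con 0ℚ) refl (2 · 1ℚ) (alternating j) ⟩
  0ℚ ∎
  where
  w a b : Fin (suc (suc m)) → ℚ
  w = alternating
  a i = identity i (suc (inject₁ j))
  b i = identity i (suc (suc j))

exchanges-eigen : ∀ {m} → 2 ∣ suc (suc m) → ∀ j → Eigen (column (exchanges m) j)
exchanges-eigen 2∣n zero    = inj₂ λ _ _ → refl
exchanges-eigen 2∣n (suc j) = inj₁ (exchanges-balanced 2∣n j)

-- Once `x zero` is known to vanish, dividing row i by its alternating sign leaves x₁ + ∑ y - 2 fᵢ =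
-- 0. Row 0 gives x₁ + ∑ y = 0, hence every fᵢ is zero; this is a triangular system for y, and y = 0
-- gives x₁ = 0.
exchanges-injective : ∀ {m} → 2 ∣ suc (suc m) → Injective (exchanges m)
exchanges-injective {m} 2∣n x Px≡0 = x≡0
  where
  x₀≡0 : x zero ≡ 0ℚ
  x₀≡0 = firstCoordinate≡0 (exchanges m) (λ _ → refl) (exchanges-balanced 2∣n) x Px≡0
  x₁ = x (suc zero)
  y : Fin m → ℚ
  y j = x (suc (suc j))
  f : Fin (suc (suc m)) → ℚ
  f i = ∑ (λ j → flips i j * y j)
  row : ∀ i → x₁ + ∑ y - 2 · 1ℚ * f i ≡ 0ℚ
  row i = x*y≡0⇒y≡0 (S₋₁₁⇒≢0 (alternating∈S₋₁₁ i)) (begin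
    w * (x₁ + ∑ y - 2 · 1ℚ * f i)
      ≡⟨ solve 5 (λ w x₁ s c t → w :* (x₁ :+ s :- c :* t) := con 1ℚ :* con 0ℚ :+ (w :* x₁ :+ w :* (s :- c :* t))) refl
           w x₁ (∑ y) (2 · 1ℚ) (f i) ⟩
    1ℚ * 0ℚ + (w * x₁ + w * (∑ y - 2 · 1ℚ * f i))
      ≡⟨ cong₂ (λ x₀ s → 1ℚ * x₀ + (w * x₁ + s)) x₀≡0 tail ⟨
    ∑ (λ j → exchanges m i j * x j)
      ≡⟨ Px≡0 i ⟩
    0ℚ ∎)
    where
    w = alternating i
    tail : ∑ (λ j → exchanges m i (suc (suc j)) * y j) ≡ w * (∑ y - 2 · 1ℚ * f i)
    tail = begin
      ∑ (λ j → w * (1ℚ - 2 · 1ℚ * flips i j) * y j)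
        ≡⟨ ∑-cong (λ j → solve 4 (λ w c f y → w :* (con 1ℚ :- c :* f) :* y := w :* (y :- c :* (f :* y))) refl
                    w (2 · 1ℚ) (flips i j) (y j)) ⟩
      ∑ (λ j → w * (y j - 2 · 1ℚ * (flips i j * y j)))
        ≡⟨ ∑-*ˡ w (λ j → y j - 2 · 1ℚ * (flips i j * y j)) ⟩
      w * ∑ (λ j → y j - 2 · 1ℚ * (flips i j * y j))
        ≡⟨ cong (w *_) (trans (∑-sub y (λ j → 2 · 1ℚ * (flips i j * y j)))
                              (cong (λ s → ∑ y - s) (∑-*ˡ (2 · 1ℚ) (λ j → flips i j * y j)))) ⟩
      w * (∑ y - 2 · 1ℚ * f i) ∎
  -- Position 0 belongs to no exchanged pair, so `flips zero j` computes to zero.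
  f₀≡0 : f zero ≡ 0ℚ
  f₀≡0 = ∑-0 (λ j → *-zeroˡ (y j))
  x₁+∑y≡0 : x₁ + ∑ y ≡ 0ℚ
  x₁+∑y≡0 = begin
    x₁ + ∑ y                     ≡⟨ solve 2 (λ s c → s := s :- c :* con 0ℚ) refl (x₁ + ∑ y) (2 · 1ℚ) ⟩
    x₁ + ∑ y - 2 · 1ℚ * 0ℚ       ≡⟨ cong (λ t → x₁ + ∑ y - 2 · 1ℚ * t) f₀≡0 ⟨
    x₁ + ∑ y - 2 · 1ℚ * f zero   ≡⟨ row zero ⟩
    0ℚ                           ∎
  f≡0 : ∀ i → f i ≡ 0ℚ
  f≡0 i = x*y≡0⇒y≡0 {x = - (2 · 1ℚ)} (λ ()) (begin
    - (2 · 1ℚ) * f i          ≡⟨ solve 2 (λ c t → :- c :* t := con 0ℚ :- c :* t) refl (2 · 1ℚ) (f i) ⟩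
    0ℚ - 2 · 1ℚ * f i         ≡⟨ cong (λ s → s - 2 · 1ℚ * f i) x₁+∑y≡0 ⟨
    x₁ + ∑ y - 2 · 1ℚ * f i   ≡⟨ row i ⟩
    0ℚ                        ∎)
  -- Rows 1 to m: the pair of column j begins at position j + 1, which puts ones on the diagonal and
  -- zeros above it.
  T : Matrix m
  T k j = flips (suc (inject₁ k)) j
  T-upper : ∀ {k j} → k Fin.< j → T k j ≡ 0ℚ
  T-upper k<j = cong₂ _+_ (identity-off (<⇒≢ k<j ∘ inject₁-injective ∘ suc-injective))
                          (identity-off (inject₁≢suc (ℕ.<⇒≤ k<j) ∘ suc-injective))
  T-diag : ∀ k → T k k ≢ 0ℚ
  T-diag k Tₖₖ≡0 with () ← trans (sym (cong₂ _+_ (identity-diag (suc (inject₁ k)))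
    (identity-off (inject₁≢suc {i = k} {k} ℕ.≤-refl ∘ suc-injective)))) Tₖₖ≡0
  y≡0 : ∀ j → y j ≡ 0ℚ
  y≡0 = lowerTriangular-injective T T-upper T-diag y (λ k → f≡0 (suc (inject₁ k)))
  x≡0 : ∀ j → x j ≡ 0ℚ
  x≡0 zero          = x₀≡0
  x≡0 (suc zero)    = trans (sym (trans (cong (x₁ +_) (∑-0 y≡0)) (+-identityʳ x₁))) x₁+∑y≡0
  x≡0 (suc (suc j)) = y≡0 j

exchanges-diagonalizes : ∀ {m} → 2 ∣ suc (suc m) →
  Diagonalizes S₋₁₁ (completeGraph (suc (suc m))) (exchanges m)
exchanges-diagonalizes {m} 2∣n = diagonalizes-complete S₋₁₁ (exchanges m)
  (exchanges-entries m) (exchanges-injective 2∣n) (exchanges-eigen 2∣n)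

-- Matrices with orthogonal columns

gram : ∀ {n} → Matrix n → Matrix n
gram P = transpose P ⊗ P

-- Applying the transpose of P to Px = 0 leaves the squared norm of column i times xᵢ.
orthogonal⇒injective : ∀ {n} (P : Matrix n) → IsDiagonal (gram P) → (∀ i → gram P i i ≢ 0ℚ) → Injective P
orthogonal⇒injective {n} P diagonal norm≢0 x Px≡0 i = x*y≡0⇒y≡0 (norm≢0 i) (begin
  gram P i i * x i              ≡⟨ ∑-single {f = λ j → gram P i j * x j} i (λ j j≢i →
                                     trans (cong (_* x j) (diagonal i j (j≢i ∘ sym))) (*-zeroˡ (x j))) ⟨
  (gram P ⊗ X) i i              ≡⟨ ⊗-assoc (transpose P) P X i i ⟩
  ∑ (λ k → P k i * (P ⊗ X) k i) ≡⟨ ∑-0 (λ k → trans (cong (P k i *_) (Px≡0 k)) (*-zeroʳ (P k i))) ⟩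
  0ℚ                            ∎)
  where
  X : Matrix n
  X j _ = x j

-- Invertibility takes the place of positivity of squares. A zero norm would make the whole i-th
-- column of PᵀP zero; multiplying by Qᵀ makes column i of P zero, against QP = I.
diagonalizes⇒norm≢0 : ∀ {n} (S : Subset) (G : Graph n) {P : Matrix n} → Diagonalizes S G P →
  IsDiagonal (gram P) → ∀ i → gram P i i ≢ 0ℚ
diagonalizes⇒norm≢0 {n} S G {P} (_ , Q , QP≡I , PQ≡I , _) diagonal i norm≡0 =
  contradiction 1≡0 λ ()
  where
  gramᵢ≡0 : ∀ m → gram P m i ≡ 0ℚ
  gramᵢ≡0 m with m ≟ i
  ... | yes refl = norm≡0
  ... | no m≢i   = diagonal m i m≢i
  column≡0 : ∀ k → P k i ≡ 0ℚ
  column≡0 k = begin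
    P k i                                        ≡⟨ ∑-identity-* (column P i) k ⟨
    ∑ (λ l → identity k l * P l i)               ≡⟨ ∑-cong (λ l → cong (_* P l i) (begin
      identity k l                                   ≡⟨ identity-sym k l ⟩
      identity l k                                   ≡⟨ PQ≡I l k ⟨
      ∑ (λ m → P l m * Q m k)                        ≡⟨ ∑-cong (λ m → *-comm (P l m) (Q m k)) ⟩
      (transpose Q ⊗ transpose P) k l                ∎)) ⟩
    (transpose Q ⊗ transpose P ⊗ P) k i          ≡⟨ ⊗-assoc (transpose Q) (transpose P) P k i ⟩
    ∑ (λ m → Q m k * gram P m i)                 ≡⟨ ∑-0 (λ m → trans (cong (Q m k *_) (gramᵢ≡0 m)) (*-zeroʳ (Q m k))) ⟩
    0ℚ                                           ∎
  1≡0 : 1ℚ ≡ 0ℚ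
  1≡0 = begin
    1ℚ                       ≡⟨ identity-diag i ⟨
    identity i i             ≡⟨ QP≡I i i ⟨
    ∑ (λ k → Q i k * P k i)  ≡⟨ ∑-0 (λ k → trans (cong (Q i k *_) (column≡0 k)) (*-zeroʳ (Q i k))) ⟩
    0ℚ                       ∎

-- Searching the matrices with entries -1, 0, 1

trit : Fin 3 → ℚ
trit zero             = - 1ℚ
trit (suc zero)       = 0ℚ
trit (suc (suc zero)) = 1ℚ

trit∈S₋₁₀₁ : ∀ t → S₋₁₀₁ (trit t)
trit∈S₋₁₀₁ zero             = inj₁ refl
trit∈S₋₁₀₁ (suc zero)       = inj₂ (inj₁ refl)
trit∈S₋₁₀₁ (suc (suc zero)) = inj₂ (inj₂ refl)

trit⁻¹ : ∀ {x} → S₋₁₀₁ x → ∃ λ t → trit t ≡ x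
trit⁻¹ (inj₁ refl)        = zero , refl
trit⁻¹ (inj₂ (inj₁ refl)) = suc zero , refl
trit⁻¹ (inj₂ (inj₂ refl)) = suc (suc zero) , refl

-- A row is coded by n ternary digits and a matrix by n row codes, so the search runs over a finite
-- type. Decoding returns the original matrix only up to pointwise equality, hence the condition
-- that `R` respects it.
any-S₋₁₀₁-matrix? : ∀ {n} {R : Matrix n → Set} → (∀ P → Dec (R P)) →
  (∀ {M N} → (∀ i j → M i j ≡ N i j) → R M → R N) →
  Dec (Σ (Matrix n) λ P → EntriesIn S₋₁₀₁ P × R P)
any-S₋₁₀₁-matrix? {n} {R} R? R-resp = map′
  (λ { (c , Rc) → decode c , (λ i j → trit∈S₋₁₀₁ (finToFun (finToFun c i) j)) , Rc })
  (λ { (P , entries , RP) → encode entries , R-resp (λ i j → sym (decode-encode entries i j)) RP })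
  (any? (λ c → R? (decode c)))
  where
  decode : Fin ((3 ℕ.^ n) ℕ.^ n) → Matrix n
  decode c i j = trit (finToFun (finToFun c i) j)
  row : ∀ {P} → EntriesIn S₋₁₀₁ P → Fin n → Fin (3 ℕ.^ n)
  row entries i = funToFin (λ j → proj₁ (trit⁻¹ (entries i j)))
  encode : ∀ {P} → EntriesIn S₋₁₀₁ P → Fin ((3 ℕ.^ n) ℕ.^ n)
  encode entries = funToFin (row entries)
  decode-encode : ∀ {P} (entries : EntriesIn S₋₁₀₁ P) i j → decode (encode entries) i j ≡ P i j
  decode-encode {P} entries i j = begin
    trit (finToFun (finToFun (encode entries) i) j)
      ≡⟨ cong (λ r → trit (finToFun r j)) (finToFun-funToFin (row entries) i) ⟩
    trit (finToFun (row entries i) j)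
      ≡⟨ cong trit (finToFun-funToFin (λ j → proj₁ (trit⁻¹ (entries i j))) j) ⟩
    trit (proj₁ (trit⁻¹ (entries i j)))
      ≡⟨ proj₂ (trit⁻¹ (entries i j)) ⟩
    P i j ∎

-- For P with entries in S this amounts to diagonalizing Kₙ with a diagonal Gram matrix, but it
-- mentions no inverse and is decided by finitely many comparisons in ℚ.
OrthogonalEigenbasis : ∀ {n} → Matrix n → Set
OrthogonalEigenbasis P =
  IsDiagonal (gram P) × (∀ i → gram P i i ≢ 0ℚ) × (∀ j → Eigen (column P j))

orthogonalEigenbasis? : ∀ {n} (P : Matrix n) → Dec (OrthogonalEigenbasis P)
orthogonalEigenbasis? P =
  all? (λ i → all? λ j → ¬? (i ≟ j) →-dec (gram P i j ≟ℚ 0ℚ))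
  ×-dec all? (λ i → ¬? (gram P i i ≟ℚ 0ℚ))
  ×-dec all? (λ j → (∑ (column P j) ≟ℚ 0ℚ) ⊎-dec all? (λ i → all? λ i′ → P i j ≟ℚ P i′ j))

orthogonalEigenbasis-resp : ∀ {n} {M N : Matrix n} → (∀ i j → M i j ≡ N i j) →
  OrthogonalEigenbasis M → OrthogonalEigenbasis N
orthogonalEigenbasis-resp {n} {M} {N} M≡N (diagonal , norm≢0 , eigen) =
  (λ i j i≢j → trans (sym (gram≡ i j)) (diagonal i j i≢j)) ,
  (λ i → norm≢0 i ∘ trans (gram≡ i i)) ,
  (λ j → eigen-resp j (eigen j))
  where
  gram≡ : ∀ i j → gram M i j ≡ gram N i j
  gram≡ i j = ∑-cong (λ k → cong₂ _*_ (M≡N k i) (M≡N k j))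
  eigen-resp : ∀ j → Eigen (column M j) → Eigen (column N j)
  eigen-resp j (inj₁ ∑≡0)   = inj₁ (trans (sym (∑-cong (λ i → M≡N i j))) ∑≡0)
  eigen-resp j (inj₂ const) = inj₂ λ i i′ → trans (sym (M≡N i j)) (trans (const i i′) (M≡N i′ j))

orthogonalEigenbasis⇒diagonalizes : ∀ {n} (S : Subset) {P : Matrix n} → EntriesIn S P →
  OrthogonalEigenbasis P → Diagonalizes S (completeGraph n) P
orthogonalEigenbasis⇒diagonalizes S {P} entries (diagonal , norm≢0 , eigen) =
  diagonalizes-complete S P entries (orthogonal⇒injective P diagonal norm≢0) eigen

≢⇒dist>0 : ∀ {n} {i j : Fin n} → i ≢ j → 1 ≤ dist i j
≢⇒dist>0 {i = zero}  {zero}  i≢j = contradiction refl i≢j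
≢⇒dist>0 {i = zero}  {suc j} _   = s≤s z≤n
≢⇒dist>0 {i = suc i} {zero}  _   = s≤s z≤n
≢⇒dist>0 {i = suc i} {suc j} i≢j = ≢⇒dist>0 (i≢j ∘ cong suc)

diagonal⇒bandwidth-1 : ∀ {n} {M : Matrix n} → IsDiagonal M → IsBandwidth M 1
diagonal⇒bandwidth-1 diagonal =
  ℕ.≤-refl , (λ i j 1≤d → diagonal i j (dist>0⇒≢ 1≤d)) , λ _ 1≤k′ _ → 1≤k′

orthogonalEigenbasis⇒sBandwidth-1 : ∀ {n} (S : Subset) (P : Matrix n) → EntriesIn S P →
  OrthogonalEigenbasis P → IsSBandwidth S (completeGraph n) 1
orthogonalEigenbasis⇒sBandwidth-1 S P entries basis =
  (P , orthogonalEigenbasis⇒diagonalizes S entries basis , diagonal⇒bandwidth-1 {M = gram P} (proj₁ basis)) ,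
  λ _ _ _ (1≤k′ , _) → 1≤k′

S₋₁₀₁-bandwidth : ∀ m → Σ ℕ λ k → IsSBandwidth S₋₁₀₁ (completeGraph (suc m)) k × k ≤ 2
S₋₁₀₁-bandwidth m = decided (any-S₋₁₀₁-matrix? orthogonalEigenbasis? orthogonalEigenbasis-resp)
  where
  decided : Dec (Σ (Matrix (suc m)) λ P → EntriesIn S₋₁₀₁ P × OrthogonalEigenbasis P) →
    Σ ℕ λ k → IsSBandwidth S₋₁₀₁ (completeGraph (suc m)) k × k ≤ 2
  decided (yes (P , entries , basis)) = 1 , orthogonalEigenbasis⇒sBandwidth-1 S₋₁₀₁ P entries basis , s≤s z≤n
  decided (no ¬basis) = 2 ,
    ((differences m , differences-diagonalizes m ,
      s≤s z≤n , differences-band m , λ k′ → ≥2 (differences m) k′ (differences-diagonalizes m)) ,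
     λ P k′ diag (1≤k′ , band , _) → ≥2 P k′ diag 1≤k′ band) ,
    ℕ.≤-refl
    where
    -- Phrased for any band rather than an exact bandwidth, so that it yields both the exact
    -- bandwidth of `differences m` and the lower bound over all P.
    ≥2 : ∀ P k′ → Diagonalizes S₋₁₀₁ (completeGraph (suc m)) P → 1 ≤ k′ → ZeroOutsideBand (gram P) k′ → 2 ≤ k′
    ≥2 P zero          diag ()
    ≥2 P (suc (suc k)) diag _ _  = s≤s (s≤s z≤n)
    -- Band 1 means a diagonal Gram matrix, and P would be the basis that the search has excluded.
    ≥2 P (suc zero) diag _ band = contradiction (P , proj₁ diag , diagonal ,
      diagonalizes⇒norm≢0 S₋₁₀₁ (completeGraph (suc m)) diag diagonal , diagonalizes-complete⇒eigen S₋₁₀₁ diag) ¬basis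
      where
      diagonal : IsDiagonal (gram P)
      diagonal i j i≢j = band i j (≢⇒dist>0 i≢j)

-- Hadamard matrices

S₋₁₁-square : ∀ {x} → S₋₁₁ x → x * x ≡ 1ℚ
S₋₁₁-square (inj₁ refl) = refl
S₋₁₁-square (inj₂ refl) = refl

-- Multiplying each row by its first entry preserves the inner products of columns and turns the
-- first column into the all-ones vector; orthogonality to it makes the other columns balanced.
hadamard⇒bandwidth-1 : ∀ m → HadamardExists (suc m) → IsSBandwidth S₋₁₁ (completeGraph (suc m)) 1
hadamard⇒bandwidth-1 m (H , entries , orthogonal) =
  orthogonalEigenbasis⇒sBandwidth-1 S₋₁₁ P P-entries (P-diagonal , P-norm≢0 , eigen)
  where
  P : Matrix (suc m)
  P i j = H i j * H i zero
  P-entries : EntriesIn S₋₁₁ P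
  P-entries i j = S₋₁₁-* (entries i j) (entries i zero)
  P-diagonal : IsDiagonal (gram P)
  P-diagonal i j i≢j = begin
    ∑ (λ k → H k i * H k zero * (H k j * H k zero))
      ≡⟨ ∑-cong (λ k → trans
           (solve 3 (λ a b c → a :* c :* (b :* c) := a :* b :* (c :* c)) refl (H k i) (H k j) (H k zero))
           (trans (cong (H k i * H k j *_) (S₋₁₁-square (entries k zero))) (*-identityʳ (H k i * H k j)))) ⟩
    ∑ (λ k → H k i * H k j)
      ≡⟨ orthogonal i j i≢j ⟩
    0ℚ ∎
  P-norm≢0 : ∀ i → gram P i i ≢ 0ℚ
  P-norm≢0 i norm≡0 = suc·1≢0 m (begin
    suc m · 1ℚ                   ≡⟨ ∑-const (suc m) 1ℚ ⟨
    ∑ {suc m} (λ _ → 1ℚ)         ≡⟨ ∑-cong (λ k → S₋₁₁-square (P-entries k i)) ⟨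
    gram P i i                   ≡⟨ norm≡0 ⟩
    0ℚ                           ∎)
  eigen : ∀ j → Eigen (column P j)
  eigen zero    = inj₂ λ i i′ → trans (S₋₁₁-square (entries i zero)) (sym (S₋₁₁-square (entries i′ zero)))
  eigen (suc j) = inj₁ (orthogonal (suc j) zero λ ())

-- Diagonalizability over ±1

-- For n at least 2 the first two columns cannot both be constant, so one of them is balanced and n
-- is even.
S₋₁₁-diagonalizable⇒ : ∀ m → SDiagonalizable S₋₁₁ (completeGraph (suc m)) → suc m ≡ 1 ⊎ 2 ∣ suc m
S₋₁₁-diagonalizable⇒ zero    _ = inj₁ refl
S₋₁₁-diagonalizable⇒ (suc m) (P , diag) =
  inj₂ (even (diagonalizes-complete⇒eigen S₋₁₁ diag zero) (diagonalizes-complete⇒eigen S₋₁₁ diag (suc zero)))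
  where
  even : Eigen (column P zero) → Eigen (column P (suc zero)) → 2 ∣ suc (suc m)
  even (inj₁ b) _        = balanced⇒2∣n (column P zero) (λ i → proj₁ diag i zero) b
  even _        (inj₁ b) = balanced⇒2∣n (column P (suc zero)) (λ i → proj₁ diag i (suc zero)) b
  even (inj₂ c) (inj₂ d) = contradiction
    (constantColumn-unique (proj₁ diag) (diagonalizes⇒injective S₋₁₁ (completeGraph (suc (suc m))) diag) {zero} {suc zero} c d)
    λ ()

S₋₁₁-diagonalizable⇐ : ∀ m → suc m ≡ 1 ⊎ 2 ∣ suc m → SDiagonalizable S₋₁₁ (completeGraph (suc m))
S₋₁₁-diagonalizable⇐ zero    _          = P , diagonalizes-complete S₋₁₁ P (λ _ _ → inj₂ refl)
  (λ { x Px≡0 zero → firstCoordinate≡0 P (λ _ → refl) (λ ()) x Px≡0 }) (λ _ → inj₂ λ _ _ → refl)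
  where
  P : Matrix 1
  P _ _ = 1ℚ
S₋₁₁-diagonalizable⇐ (suc m) (inj₂ 2∣n) = exchanges m , exchanges-diagonalizes 2∣n

-- Bandwidth over ±1 for n ≡ 2 (mod 4)

∸+∸≤ : ∀ {a b m} → a ≤ m → b ≤ m → (a ∸ b) ℕ.+ (b ∸ a) ≤ m
∸+∸≤ {zero}  {b} {m} _         b≤m       = subst (_≤ m) (sym (cong (ℕ._+ b) (ℕ.0∸n≡0 b))) b≤m
∸+∸≤ {suc a} {zero} {m} a≤m    _         = subst (_≤ m) (sym (ℕ.+-identityʳ (suc a))) a≤m
∸+∸≤ {suc a} {suc b} (s≤s a≤m) (s≤s b≤m) = ℕ.m≤n⇒m≤1+n (∸+∸≤ a≤m b≤m)

-- Balance makes the first row and column vanish off the diagonal. Any two other columns are at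
-- distance at most m, one short of the band m + 1 = n - 1.
exchanges-band : ∀ {m} → 2 ∣ suc (suc m) → ZeroOutsideBand (gram (exchanges m)) (suc m)
exchanges-band {m} 2∣n zero    zero    ()
exchanges-band {m} 2∣n zero    (suc j) _ = trans (∑-1* (column (exchanges m) (suc j))) (exchanges-balanced 2∣n j)
exchanges-band {m} 2∣n (suc j) zero    _ = trans (∑-*1 (column (exchanges m) (suc j))) (exchanges-balanced 2∣n j)
exchanges-band {m} 2∣n (suc i) (suc j) m<d =
  contradiction (ℕ.≤-trans m<d (∸+∸≤ (ℕ.≤-pred (toℕ<n i)) (ℕ.≤-pred (toℕ<n j)))) ℕ.1+n≰n

-- If both columns were balanced, their orthogonality would give 4 ∣ n.
orthogonal⇒constant : ∀ {n} → n % 4 ≡ 2 → (P : Matrix n) → Diagonalizes S₋₁₁ (completeGraph n) P →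
  ∀ i j → gram P i j ≡ 0ℚ → Constant (column P i) ⊎ Constant (column P j)
orthogonal⇒constant {n} n%4≡2 P diag i j i⊥j =
  either (diagonalizes-complete⇒eigen S₋₁₁ diag i) (diagonalizes-complete⇒eigen S₋₁₁ diag j)
  where
  either : Eigen (column P i) → Eigen (column P j) → Constant (column P i) ⊎ Constant (column P j)
  either (inj₂ c) _        = inj₁ c
  either _        (inj₂ c) = inj₂ c
  either (inj₁ a) (inj₁ b) = contradiction (trans (sym (n∣m⇒m%n≡0 n 4 4∣n)) n%4≡2) λ ()
    where
    4∣n : 4 ∣ n
    4∣n = balanced-orthogonal⇒4∣n (column P i) (column P j)
      (λ k → proj₁ diag k i) (λ k → proj₁ diag k j) a b i⊥j

-- A band of width at most n - 2 makes two disjoint pairs of columns orthogonal. Each pair then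
-- contains a constant column, while at most one column is constant. For n = 2 the bound is just 1 ≤
-- k.
S₋₁₁-bandwidth≥ : ∀ n → n % 4 ≡ 2 → (P : Matrix n) → Diagonalizes S₋₁₁ (completeGraph n) P →
  ∀ k → 1 ≤ k → ZeroOutsideBand (gram P) k → n ∸ 1 ≤ k
S₋₁₁-bandwidth≥ 2 _ P diag k 1≤k _ = 1≤k
S₋₁₁-bandwidth≥ n@(suc (suc (suc (suc m)))) n%4≡2 P diag k 1≤k band with (3 ℕ.+ m) ℕ.≤? k
... | yes n-1≤k = n-1≤k
... | no  n-1≰k = contradiction (constant j₀ j₂ d₀₂) (λ c → clash c (constant j₁ j₃ d₁₃))
  where
  -- The pairs (j₀, j₂) and (j₁, j₃) are the disjoint pairs of columns at distance n − 2.
  j₀ j₁ j₂ j₃ : Fin n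
  j₀ = zero
  j₁ = suc zero
  j₂ = suc (suc (inject₁ (fromℕ m)))
  j₃ = suc (suc (suc (fromℕ m)))
  k≤2+m : k ≤ 2 ℕ.+ m
  k≤2+m = ℕ.≤-pred (ℕ.≰⇒> n-1≰k)
  d₀₂ : k ≤ dist j₀ j₂
  d₀₂ = subst (λ d → k ≤ 2 ℕ.+ d) (sym (trans (toℕ-inject₁ (fromℕ m)) (toℕ-fromℕ m))) k≤2+m
  d₁₃ : k ≤ dist j₁ j₃
  d₁₃ = subst (λ d → k ≤ 2 ℕ.+ d) (sym (toℕ-fromℕ m)) k≤2+m
  constant : ∀ i j → k ≤ dist i j → Constant (column P i) ⊎ Constant (column P j)
  constant i j k≤d = orthogonal⇒constant n%4≡2 P diag i j (band i j k≤d)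
  unique : ∀ {i j} → Constant (column P i) → Constant (column P j) → i ≡ j
  unique = constantColumn-unique (proj₁ diag) (diagonalizes⇒injective S₋₁₁ (completeGraph n) diag)
  clash : Constant (column P j₀) ⊎ Constant (column P j₂) → ¬ (Constant (column P j₁) ⊎ Constant (column P j₃))
  clash (inj₁ c₀) (inj₁ c₁) = contradiction (unique {j₀} {j₁} c₀ c₁) λ ()
  clash (inj₁ c₀) (inj₂ c₃) = contradiction (unique {j₀} {j₃} c₀ c₃) λ ()
  clash (inj₂ c₂) (inj₁ c₁) = contradiction (unique {j₂} {j₁} c₂ c₁) λ ()
  clash (inj₂ c₂) (inj₂ c₃) =
    inject₁≢suc {i = fromℕ m} {fromℕ m} ℕ.≤-refl (suc-injective (suc-injective (unique {j₂} {j₃} c₂ c₃)))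

S₋₁₁-bandwidth : ∀ n → n % 4 ≡ 2 → IsSBandwidth S₋₁₁ (completeGraph n) (n ∸ 1)
S₋₁₁-bandwidth n@(suc (suc m)) n%4≡2 =
  (exchanges m , exchanges-diagonalizes 2∣n , s≤s z≤n , exchanges-band 2∣n ,
   S₋₁₁-bandwidth≥ n n%4≡2 (exchanges m) (exchanges-diagonalizes 2∣n)) ,
  λ P k′ diag (1≤k′ , band , _) → S₋₁₁-bandwidth≥ n n%4≡2 P diag k′ 1≤k′ band
  where
  2∣n : 2 ∣ n
  -- With q = n / 4, n = 2 + 4 q = (1 + 2 q) 2.
  2∣n = divides (suc (n ℕ./ 4 ℕ.* 2)) (trans (m≡m%n+[m/n]*n n 4)
          (cong₂ ℕ._+_ n%4≡2 (sym (ℕ.*-assoc (n ℕ./ 4) 2 2))))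

theorem4p3 : (n : ℕ) → 1 ≤ n →
    ( SDiagonalizable S₋₁₀₁ (completeGraph n)
    × Σ ℕ (λ k → IsSBandwidth S₋₁₀₁ (completeGraph n) k × k ≤ 2) )
    ×
    ( (SDiagonalizable S₋₁₁ (completeGraph n) ⇔ (n ≡ 1 ⊎ 2 ∣ n))
    × (n % 4 ≡ 2 → IsSBandwidth S₋₁₁ (completeGraph n) (n ∸ 1))
    × (HadamardExists n → IsSBandwidth S₋₁₁ (completeGraph n) 1) )
theorem4p3 (suc m) _ =
  ((differences m , differences-diagonalizes m) , S₋₁₀₁-bandwidth m) ,
  mk⇔ (S₋₁₁-diagonalizable⇒ m) (S₋₁₁-diagonalizable⇐ m) ,
  S₋₁₁-bandwidth (suc m) ,
  hadamard⇒bandwidth-1 m
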